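{- Let $d \geq 4$ be an integer and let $n$ be a sufficiently large integer. If $q$ is a positive integer with $q \leq n/(1000 d)$, then, playing the $(q:1)$ Waiter-Client game on $E(K_n)$, Waiter has a strategy to ensure that after at most $200 n d$ rounds, Client's graph $G_C$ satisfies all of the following properties: (i) $G_C$ is a $(d/2-1, 1/(20d))$-expander; (ii) $G_C$ contains a cycle of length $k$ for every $3 \leq k \leq \lceil n/6 \rceil$; (iii) $G_C$ is connected.
   Context: The $(q:1)$ Waiter-Client game on $E(K_n)$ (for a positive integer $q$) is the following two-player perfect information game. In each round, Waiter offers Client exactly $q+1$ edges of the complete graph $K_n$ which have not been claimed before; Client chooses one of these edges, which he keeps, and the remaining $q$ edges are claimed by Waiter. If fewer than $q+1$ unclaimed edges remain, all of them are claimed by Waiter. The game ends when all edges of $K_n$ have been claimed. At any point of the game, Client's graph $G_C$ is the graph with vertex set $V(K_n)$ whose edges are all the edges claimed so far by Client. For a graph $G$ and $S \subseteq V(G)$, $N_G(S) = \{v \in V(G) \setminus S : \exists u \in S \text{ such that } uv \in E(G)\}$. For real numbers $d' \geq 1$ and $0 < \varepsilon < 1$, a graph $G$ is called a $(d',\varepsilon)$-expander if $|N_G(S)| \geq d'|S|$ holds for every $S \subseteq V(G)$ with $|S| \leq \varepsilon |V(G)|$. -}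

module Defs where

open import Level using (0ℓ)
open import Data.Nat using (ℕ; zero; suc; _≤_; _≤?_)
open import Data.Integer using (+_)
open import Data.Rational as ℚ using (ℚ)
open import Data.Fin as Fin using (Fin; toℕ)
import Data.Fin.Properties as Fin
open import Data.Fin.Subset using (Subset; ∣_∣)
open import Data.Fin.Subset.Properties using () renaming (_∈?_ to _∈ˢ?_)
open import Data.List using (List; []; _∷_; _++_; length; mapMaybe; concatMap; filter; allFin)
open import Data.List.Relation.Unary.Any as Any using (Any)
import Data.List.Membership.DecPropositional as DecMembership
open import Data.List.Membership.Propositional using (_∈_)
import Data.Maybe as Maybe
open import Data.Product using (Σ-syntax; ∃; ∃₂; ∃-syntax; _×_; _,_; proj₁; proj₂)
open import Data.Product.Properties using (≡-dec)
open import Data.Sum using (_⊎_; inj₁; inj₂; swap)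
open import Data.Vec using (Vec; tabulate; lookup; removeAt; toList)
open import Data.Vec.Relation.Unary.All using (All)
open import Data.Vec.Relation.Unary.Unique.Propositional using (Unique)
open import Function.Definitions using (Injective)
open import Relation.Binary.Core using (Rel)
open import Relation.Binary.Definitions using (Symmetric; Irreflexive; Decidable; DecidableEquality)
open import Relation.Binary.Construct.Closure.ReflexiveTransitive using (Star)
open import Relation.Binary.PropositionalEquality using (_≡_; refl)
open import Relation.Nullary using (¬_; yes; no; does)
open import Relation.Nullary.Decidable using (dec⇒maybe; ¬?; _×-dec_; _⊎-dec_)

fromℕ : ℕ → ℚ
fromℕ m = + m ℚ./ 1

record Graph (n : ℕ) : Set₁ where
  field
    Adj     : Rel (Fin n) 0ℓ
    adj?    : Decidable Adj
    symm    : Symmetric Adj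
    irrefl  : Irreflexive _≡_ Adj

open Graph public

N : ∀ {n} → Graph n → Subset n → Subset n
N G S = tabulate λ v →
  does (¬? (v ∈ˢ? S) ×-dec Fin.any? λ u → (u ∈ˢ? S) ×-dec adj? G u v)

IsExpander : ∀ {n} → ℚ → ℚ → Graph n → Set
IsExpander {n} d′ ε G = (S : Subset n) →
  fromℕ ∣ S ∣ ℚ.≤ ε ℚ.* fromℕ n →
  d′ ℚ.* fromℕ ∣ S ∣ ℚ.≤ fromℕ ∣ N G S ∣

CyclicSucc : ∀ {k} → Fin k → Fin k → Set
CyclicSucc {k} i j =
  (toℕ j ≡ suc (toℕ i)) ⊎ (suc (toℕ i) ≡ k × toℕ j ≡ 0)

record Cycle {n : ℕ} (G : Graph n) (k : ℕ) : Set where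
  field
    3≤k      : 3 ≤ k
    vertex   : Fin k → Fin n
    distinct : Injective _≡_ _≡_ vertex
    adjacent : ∀ i j → CyclicSucc i j → Adj G (vertex i) (vertex j)

Connected : ∀ {n} → Graph n → Set
Connected G = ∀ u v → Star (Adj G) u v

-- An edge {u, v} of Kₙ is represented by its increasing pair of endpoints.
Edge : ℕ → Set
Edge n = ∃₂ λ (u v : Fin n) → u Fin.< v

_≟ᴱ_ : ∀ {n} → DecidableEquality (Edge n)
_≟ᴱ_ = ≡-dec Fin._≟_ (≡-dec Fin._≟_ λ p q → yes (Fin.<-irrelevant p q))

allEdges : ∀ n → List (Edge n)
allEdges n = concatMap
  (λ u → mapMaybe (λ v → Maybe.map (λ u<v → u , v , u<v) (dec⇒maybe (u Fin.<? v))) (allFin n))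
  (allFin n)

Joins : ∀ {n} → Fin n → Fin n → Edge n → Set
Joins u v (a , b , _) = (a ≡ u × b ≡ v) ⊎ (a ≡ v × b ≡ u)

-- The claimed edges are listed with the most recent first, so that a position
-- of an actual play also records the order in which the edges were claimed.
record Position (n : ℕ) : Set where
  field
    client : List (Edge n)
    waiter : List (Edge n)

open Position public

start : ∀ {n} → Position n
start = record { client = [] ; waiter = [] }

unclaimed : ∀ {n} → Position n → List (Edge n)
unclaimed {n} p = filter (λ e → ¬? (e ∈? (client p ++ waiter p))) (allEdges n)
  where open DecMembership (_≟ᴱ_ {n}) using (_∈?_)

clientGraph : ∀ {n} → Position n → Graph n
clientGraph p = record
  { Adj    = λ u v → Any (Joins u v) (client p)
  ; adj?   = λ u v → Any.any? (λ (a , b , _) →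
               ((a Fin.≟ u) ×-dec (b Fin.≟ v)) ⊎-dec ((a Fin.≟ v) ×-dec (b Fin.≟ u))) (client p)
  ; symm   = Any.map swap
  ; irrefl = λ { refl uu → loopless (Any.satisfied uu) }
  }
  where
  loopless : ∀ {n} {u : Fin n} → ¬ ∃ (Joins u u)
  loopless ((_ , _ , a<b) , inj₁ (refl , refl)) = Fin.<-irrefl refl a<b
  loopless ((_ , _ , a<b) , inj₂ (refl , refl)) = Fin.<-irrefl refl a<b

record Offer {n : ℕ} (q : ℕ) (p : Position n) : Set where
  field
    edges    : Vec (Edge n) (suc q)
    distinct : Unique edges
    free     : All (_∈ unclaimed p) edges

open Offer public using (edges)

WaiterStrategy : ℕ → ℕ → Set
WaiterStrategy n q = (p : Position n) → suc q ≤ length (unclaimed p) → Offer q p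

-- Client answers with the index of the edge he keeps.
ClientStrategy : ℕ → ℕ → Set
ClientStrategy n q = (p : Position n) → Offer q p → Fin (suc q)

claim : ∀ {n q} (p : Position n) → Offer q p → Fin (suc q) → Position n
claim p o i = record
  { client = lookup (edges o) i ∷ client p
  ; waiter = toList (removeAt (edges o) i) ++ waiter p
  }

round : ∀ {n q} → WaiterStrategy n q → ClientStrategy n q → Position n → Position n
round {q = q} σ τ p with suc q ≤? length (unclaimed p)
... | yes enough = let o = σ p enough in claim p o (τ p o)
... | no  _      = record { client = client p ; waiter = unclaimed p ++ waiter p }

-- Once every edge is claimed, further rounds leave the position unchanged.
play : ∀ {n q} → WaiterStrategy n q → ClientStrategy n q → ℕ → Position n
play σ τ zero    = start
play σ τ (suc r) = round σ τ (play σ τ r)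

WaiterCanEnsure : (n q m : ℕ) → (Graph n → Set) → Set
WaiterCanEnsure n q m P =
  Σ[ σ ∈ WaiterStrategy n q ] ((τ : ClientStrategy n q) →
    ∃[ r ] (r ≤ m × P (clientGraph (play σ τ r))))

{-# OPTIONS --safe #-}
module Submission where

-- Waiter splits the vertices into three classes A → B → C → A.  Inside A he
-- first builds a path, always offering edges from its end to unvisited vertices,
-- and hangs leaves ℓ₀, …, ℓ_q on its first vertices v₀, …, v_q.  The edges
-- ℓᵢ v₍ᵢ₊ₜ₎ with t ≥ 1 are still unclaimed, and whichever of the q + 1 edges
-- with a given t Client picks, it closes a cycle of length t + 2.
--
-- Then every vertex in turn is given 4d edges into the next class (into the
-- path, when that class is A), which makes Client's graph connected.  For the
-- expansion, Waiter derandomises a union bound over the pairs S ⊆ U with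
-- ∣U∣ ≤ d∣S∣/2: if S does not expand, then S and its neighbours lie in such a U.
-- Where p is the density of U in the available edges, the pair has weight (2p)^r
-- with r the number of edges that S is still to receive.  By Markov's inequality
-- at least half of the available edges at a vertex do not increase the total
-- weight, so that Waiter can offer only such edges.  The total weight is
-- initially below 1, hence no pair survives.

open import Defs
open import Data.Bool using (true; false; if_then_else_)
open import Data.Nat as ℕ using (ℕ; zero; suc; NonZero; >-nonZero; _+_; _*_; _^_; _≤_; _<_; _≤?_; _<?_; z≤n; s≤s; s≤s⁻¹)
import Data.Nat.DivMod as ℕ
open import Data.Nat.ListAction using (sum)
open import Data.Nat.ListAction.Properties using (sum-++)
import Data.Nat.Properties as ℕ
open import Data.Nat.Properties using (m*n≢0)
open import Data.Nat.Tactic.RingSolver using (solve-∀)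
open import Data.Integer as ℤ using (+_; -[1+_])
import Data.Integer.DivMod as ℤ
import Data.Integer.Properties as ℤ
import Data.Integer.Tactic.RingSolver as ℤ
open import Data.Rational as ℚ using (↥_; ↧_; ↧ₙ_; _/_; 1ℚ; floor; ceiling)
import Data.Rational.Properties as ℚ
open import Data.Rational.Unnormalised as ℚᵘ using (mkℚᵘ; *≡*; *≤*)
import Data.Rational.Unnormalised.Properties as ℚᵘ
open import Data.Fin as Fin using (Fin; zero; suc; toℕ; fromℕ<; inject≤; punchIn)
import Data.Fin.Properties as Fin
open import Data.Fin.Subset as Subset using (Subset; ∣_∣; inside; outside; _∪_)
open import Data.Fin.Subset.Properties as Subset using (_∈?_)
open import Data.List as List using (List; []; _∷_; _++_; length; map; mapMaybe; concatMap; filter; replicate; allFin; tabulate)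
import Data.List.Properties as List
import Data.List.Membership.DecPropositional as DecMembership
open import Data.List.Membership.Propositional using (_∈_; _∉_; find; lose)
open import Data.List.Membership.Propositional.Properties
  using (∈-++⁺ˡ; ∈-++⁺ʳ; ∈-++⁻; ∈-map⁺; ∈-map⁻; ∈-concatMap⁺; ∈-concatMap⁻; ∈-filter⁺; ∈-filter⁻; ∈-tabulate⁻; ∈-allFin; ∈-lookup)
open import Data.List.Relation.Binary.Disjoint.Propositional using (Disjoint)
open import Data.List.Relation.Binary.Subset.Propositional using (_⊆_)
open import Data.List.Relation.Unary.All as All using (All; []; _∷_)
import Data.List.Relation.Unary.All.Properties as All
import Data.List.Relation.Unary.AllPairs as AllPairs
import Data.List.Relation.Unary.AllPairs.Properties as AllPairs
open import Data.List.Relation.Unary.Any as Any using (here; there)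
import Data.List.Relation.Unary.Any.Properties as Any
open import Data.List.Relation.Unary.Unique.Propositional using (Unique)
import Data.List.Relation.Unary.Unique.Propositional.Properties as Unique
open import Data.Maybe as Maybe using ()
open import Data.Product using (Σ; ∃-syntax; _×_; _,_; proj₁; proj₂)
open import Data.Sum using (_⊎_; inj₁; inj₂)
open import Data.Vec as Vec using (Vec; []; _∷_; here; removeAt; toList)
import Data.Vec.Properties as Vec
import Data.Vec.Relation.Unary.All as VecAll
import Data.Vec.Relation.Unary.All.Properties as VecAll
import Data.Vec.Relation.Unary.Unique.Propositional.Properties as VecUnique
open import Function using (_∘_; id; case_of_)
open import Function.Definitions using (Injective)
open import Relation.Binary.Construct.Closure.ReflexiveTransitive using (Star; ε; _◅_; _◅◅_; reverse)
open import Relation.Binary.Definitions using (DecidableEquality; tri<; tri≈; tri>)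
open import Relation.Binary.PropositionalEquality using (_≡_; _≢_; refl; sym; trans; cong; cong₂; subst; subst₂)
open import Relation.Nullary using (¬_; Dec; yes; no; does; contradiction)
open import Relation.Nullary.Decidable using (¬?; _×-dec_; _⊎-dec_; dec⇒maybe; dec-true; map′)
open import Relation.Unary using (Decidable)

-- The classes are arranged in a cycle so that every edge between two of them is offered on behalf
-- of one endpoint only. The choices made for one vertex then never use up the edges reserved for
-- another. The cycle stage stays inside A and does not touch these edges either.
--
-- Constants: ε = 1/(20d) and 2∣U∣ < d∣S∣ leave only sizes u = ∣U∣ ≤ n/40. With 4d edges at each
-- vertex, S receives at least 4d∣S∣ ≥ 8u edges, so a pair starts with weight at most (2u/m)^(8u),
-- where m ≥ n/8 edges are always available. There are at most (3n/u)^u 2^u pairs of size u, and the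
-- exponent 8 is large enough for these to weigh at most 2^(-u) in total. A block has n/5 vertices:
-- four blocks (path, B, C, leaves) have to fit, and the path has to exceed n/6 by a margin linear
-- in q.
--
-- The invariants below never inspect the lists of claimed edges. A round is summarised by the edge
-- that Client gained and by the edges that are still known to be unclaimed.

private variable
  n q : ℕ

-- Edges

row : Fin n → List (Fin n) → List (Edge n)
row u = mapMaybe λ v → Maybe.map (λ u<v → u , v , u<v) (dec⇒maybe (u Fin.<? v))

∈-row⁻ : ∀ (u : Fin n) vs {e} → e ∈ row u vs → proj₁ e ≡ u × proj₁ (proj₂ e) ∈ vs
∈-row⁻ u (v ∷ vs) e∈ with u Fin.<? v
∈-row⁻ u (v ∷ vs) (here refl) | yes _ = refl , here refl
∈-row⁻ u (v ∷ vs) (there e∈)  | yes _ = let eq , v∈ = ∈-row⁻ u vs e∈ in eq , there v∈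
∈-row⁻ u (v ∷ vs) e∈          | no _  = let eq , v∈ = ∈-row⁻ u vs e∈ in eq , there v∈

∈-row⁺ : ∀ {u v : Fin n} {vs} (u<v : u Fin.< v) → v ∈ vs → (u , v , u<v) ∈ row u vs
∈-row⁺ {u = u} {v} {w ∷ _} u<v v∈ with u Fin.<? w
∈-row⁺ u<v (here refl) | yes u<v′ = here (cong (λ p → _ , _ , p) (Fin.<-irrelevant u<v u<v′))
∈-row⁺ u<v (there v∈)  | yes _    = there (∈-row⁺ u<v v∈)
∈-row⁺ u<v (here refl) | no u≮v   = contradiction u<v u≮v
∈-row⁺ u<v (there v∈)  | no _     = ∈-row⁺ u<v v∈

row-unique : ∀ (u : Fin n) {vs} → Unique vs → Unique (row u vs)
row-unique u {[]} _ = AllPairs.[]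
row-unique u {v ∷ vs} (v∉ AllPairs.∷ uniq) with u Fin.<? v
... | no _  = row-unique u uniq
... | yes _ = All.tabulate (λ e∈ → λ { refl → All.lookup v∉ (proj₂ (∈-row⁻ u vs e∈)) refl })
              AllPairs.∷ row-unique u uniq

∈-allEdges : (e : Edge n) → e ∈ allEdges n
∈-allEdges {n} (u , v , u<v) = ∈-concatMap⁺ (λ u → row u (allFin n)) {xs = allFin n}
  (Any.map (λ { refl → ∈-row⁺ u<v (∈-allFin v) }) (∈-allFin u))

allEdges-unique : ∀ n → Unique (allEdges n)
allEdges-unique n = Unique.concat⁺
  (All.map⁺ (All.tabulate {xs = allFin n} λ {u} _ → row-unique u (Unique.allFin⁺ n)))
  (AllPairs.map⁺ (AllPairs.map rows-disjoint (Unique.allFin⁺ n)))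
  where
  rows-disjoint : ∀ {u v : Fin n} → u ≢ v → Disjoint (row u (allFin n)) (row v (allFin n))
  rows-disjoint {u} {v} u≢v (e∈ , e∈′) =
    u≢v (trans (sym (proj₁ (∈-row⁻ u (allFin n) e∈))) (proj₁ (∈-row⁻ v (allFin n) e∈′)))

claimed : Position n → List (Edge n)
claimed p = client p ++ waiter p

∈-unclaimed⁺ : (p : Position n) {e : Edge n} → e ∉ claimed p → e ∈ unclaimed p
∈-unclaimed⁺ {n} p {e} e∉ = ∈-filter⁺ (λ e → ¬? (e ∈ᴱ? claimed p)) (∈-allEdges e) e∉
  where open DecMembership (_≟ᴱ_ {n}) using () renaming (_∈?_ to _∈ᴱ?_)

unclaimed-unique : (p : Position n) → Unique (unclaimed p)
unclaimed-unique {n} p = Unique.filter⁺ (λ e → ¬? (e ∈ᴱ? claimed p)) (allEdges-unique n)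
  where open DecMembership (_≟ᴱ_ {n}) using () renaming (_∈?_ to _∈ᴱ?_)

lookup-unique : ∀ {A : Set} {xs : List A} → Unique xs →
  ∀ i j → List.lookup xs i ≡ List.lookup xs j → i ≡ j
lookup-unique (_  AllPairs.∷ _)    zero    zero    _  = refl
lookup-unique (x∉ AllPairs.∷ _)    zero    (suc j) eq = contradiction eq (All.lookup x∉ (∈-lookup j))
lookup-unique (x∉ AllPairs.∷ _)    (suc i) zero    eq = contradiction (sym eq) (All.lookup x∉ (∈-lookup i))
lookup-unique (_  AllPairs.∷ uniq) (suc i) (suc j) eq = cong suc (lookup-unique uniq i j eq)

-- A `WaiterStrategy` must answer at every position. This is the answer where the goal is already
-- reached or where the plan says nothing.
anyOffer : (p : Position n) → suc q ≤ length (unclaimed p) → Offer q p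
anyOffer p enough = record
  { edges    = Vec.tabulate pick
  ; distinct = VecUnique.tabulate⁺ λ eq →
      Fin.inject≤-injective enough enough _ _ (lookup-unique (unclaimed-unique p) _ _ eq)
  ; free     = VecAll.tabulate⁺ λ i → ∈-lookup (inject≤ i enough)
  }
  where
  pick = λ i → List.lookup (unclaimed p) (inject≤ i enough)

-- Sending an offered edge to its index among the unclaimed ones is injective. Hence the game cannot
-- be in its final phase at an inner node of a tree.
offer⇒enough : {p : Position n} → Offer q p → suc q ≤ length (unclaimed p)
offer⇒enough {p = p} o = Fin.injective⇒≤ {f = λ i → Any.index (∈U i)} λ {i} {j} eq →
  VecUnique.lookup-injective (Offer.distinct o) i j
    (trans (Any.lookup-index (∈U i))
      (trans (cong (List.lookup (unclaimed p)) eq) (sym (Any.lookup-index (∈U j)))))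
  where
  ∈U : ∀ i → Vec.lookup (edges o) i ∈ unclaimed p
  ∈U i = VecAll.lookup⁺ (Offer.free o) i

-- Game trees

-- In a tree the next offer may depend on whatever was fixed earlier, such as the unvisited vertices
-- or the surviving events, which a position alone does not display. The index only bounds the
-- remaining rounds, so that `done` may come early.
data Forces {n q : ℕ} (Q : Position n → Set) : ℕ → Position n → Set where
  done : ∀ {m p} → Q p → Forces Q m p
  step : ∀ {m p} (o : Offer q p) → (∀ i → Forces {q = q} Q m (claim p o i)) → Forces Q (suc m) p

weaken : ∀ {Q : Position n → Set} {k m p} → k ≤ m → Forces {q = q} Q k p → Forces {q = q} Q m p
weaken k≤m       (done Qp)  = done Qp
weaken (s≤s k≤m) (step o f) = step o λ i → weaken k≤m (f i)

mapForces : ∀ {P Q : Position n → Set} {m p} → (∀ {p′} → P p′ → Q p′) →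
  Forces {q = q} P m p → Forces {q = q} Q m p
mapForces g (done Pp)  = done (g Pp)
mapForces g (step o f) = step o λ i → mapForces g (f i)

_>>=_ : ∀ {P Q : Position n → Set} {k m p} → Forces {q = q} P k p →
        (∀ {p′} → P p′ → Forces {q = q} Q m p′) → Forces {q = q} Q (k + m) p
_>>=_ {k = k} {m} (done Pp) g = weaken (ℕ.m≤n+m m k) (g Pp)
step o f            >>= g = step o λ i → f i >>= g

-- A strategy sees only the current position, so it has to locate that position in the tree.
data Occurs {n q : ℕ} {Q : Position n → Set} : ∀ {m p₀} → Forces {q = q} Q m p₀ → Position n → Set where
  root  : ∀ {m p} {T : Forces Q m p} → Occurs T p
  child : ∀ {m p₀ p} {o : Offer q p₀} {f : ∀ i → Forces Q m (claim p₀ o i)} i →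
          Occurs (f i) p → Occurs (step o f) p

_≟ᴾ_ : DecidableEquality (Position n)
_≟ᴾ_ {n} p p′ = map′ (λ { (refl , refl) → refl }) (λ { refl → refl , refl })
  (List.≡-dec _≟ᴱ_ (client p) (client p′) ×-dec List.≡-dec _≟ᴱ_ (waiter p) (waiter p′))

module _ {Q : Position n → Set} where

  occurs? : ∀ {m p₀} (T : Forces {q = q} Q m p₀) p → Dec (Occurs T p)
  occurs? {p₀ = p₀} T p with p₀ ≟ᴾ p
  occurs? T p | yes refl = yes root
  occurs? (done _) p | no p₀≢p = no λ { root → p₀≢p refl }
  occurs? (step o f) p | no p₀≢p with Fin.any? (λ i → occurs? (f i) p)
  ... | yes (i , occ) = yes (child i occ)
  ... | no none = no λ { root → p₀≢p refl ; (child i occ) → none (i , occ) }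

  subtree : ∀ {m p₀ p} {T : Forces {q = q} Q m p₀} → Occurs T p → ∃[ k ] Forces {q = q} Q k p
  subtree {T = T} root    = _ , T
  subtree (child _ occ) = subtree occ

  occurs-child : ∀ {m p₀ p k o f} {T : Forces {q = q} Q m p₀} (occ : Occurs T p) →
    subtree occ ≡ (suc k , step o f) → ∀ i → Occurs T (claim p o i)
  occurs-child root         refl i = child i root
  occurs-child (child j occ) eq  i = child j (occurs-child occ eq i)

  occurs-length : ∀ {m p₀ p} {T : Forces {q = q} Q m p₀} → Occurs T p →
    length (client p) ≤ m + length (client p₀)
  occurs-length {m = m} root = ℕ.m≤n+m _ m
  occurs-length (child i occ) = ℕ.≤-trans (occurs-length occ) (ℕ.≤-reflexive (ℕ.+-suc _ _))

  follow : ∀ {k p} → Forces {q = q} Q k p → suc q ≤ length (unclaimed p) → Offer q p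
  follow {p = p} (done _)   enough = anyOffer p enough
  follow         (step o _) _      = o

  strategy : ∀ {m p₀} → Forces {q = q} Q m p₀ → WaiterStrategy n q
  strategy T p enough with occurs? T p
  ... | yes occ = follow (proj₂ (subtree occ)) enough
  ... | no  _   = anyOffer p enough

  -- The search in `strategy` need not return the occurrence through which the play came, so the
  -- invariant asks for some occurrence only. Client's edges count the rounds, and inside the tree
  -- there are at most m of them, so the play cannot stay there for m + 1 rounds without meeting
  -- `Q`.
  forces⇒ensures : ∀ {m} → Forces {q = q} Q m start →
    Σ (WaiterStrategy n q) λ σ → ∀ τ → ∃[ r ] (r ≤ m × Q (play σ τ r))
  forces⇒ensures {q = q} {m} T = σ , outcome
    where
    σ = strategy T

    module _ (τ : ClientStrategy n q) where
      Progress : ℕ → Set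
      Progress r = (∃[ r′ ] (r′ < r × Q (play σ τ r′)))
                 ⊎ (Occurs T (play σ τ r) × length (client (play σ τ r)) ≡ r)

      advance : ∀ r p → play σ τ r ≡ p → Occurs T p → length (client p) ≡ r → Progress (suc r)
      advance r p refl occ len with suc q ≤? length (unclaimed p)
      advance r p refl occ len | yes enough with occurs? T p
      ... | no  ¬occ = contradiction occ ¬occ
      ... | yes occ′ with subtree occ′ in eqS
      ... | _ , done Qp  = inj₁ (r , ℕ.≤-refl , Qp)
      ... | _ , step o f = inj₂ (occurs-child occ′ eqS (τ p o) , cong suc len)
      advance r p refl occ len | no ¬enough with subtree occ
      ... | _ , done Qp  = inj₁ (r , ℕ.≤-refl , Qp)
      ... | _ , step o _ = contradiction (offer⇒enough o) ¬enough

      progress : ∀ r → Progress r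
      progress zero    = inj₂ (root , refl)
      progress (suc r) with progress r
      ... | inj₁ (r′ , r′<r , Qp) = inj₁ (r′ , ℕ.m<n⇒m<1+n r′<r , Qp)
      ... | inj₂ (occ , len)      = advance r _ refl occ len

      outcome : ∃[ r ] (r ≤ m × Q (play σ τ r))
      outcome with progress (suc m)
      ... | inj₁ (r , r<1+m , Qp) = r , s≤s⁻¹ r<1+m , Qp
      ... | inj₂ (occ , len)      = contradiction
        (subst (_≤ m) len (subst (length (client (play σ τ (suc m))) ≤_) (ℕ.+-identityʳ m) (occurs-length occ)))
        ℕ.1+n≰n

-- Offers given by pairs of endpoints

SamePair : Fin n → Fin n → Fin n → Fin n → Set
SamePair u v a b = (a ≡ u × b ≡ v) ⊎ (a ≡ v × b ≡ u)

link : (u v : Fin n) → u ≢ v → Edge n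
link u v u≢v with Fin.<-cmp u v
... | tri< u<v _ _ = u , v , u<v
... | tri≈ _ u≡v _ = contradiction u≡v u≢v
... | tri> _ _ v<u = v , u , v<u

joins-link : ∀ (u v : Fin n) u≢v → Joins u v (link u v u≢v)
joins-link u v u≢v with Fin.<-cmp u v
... | tri< _ _ _ = inj₁ (refl , refl)
... | tri≈ _ u≡v _ = contradiction u≡v u≢v
... | tri> _ _ _ = inj₂ (refl , refl)

joins-samePair : ∀ {u v a b : Fin n} e → Joins u v e → Joins a b e → SamePair u v a b
joins-samePair _ (inj₁ (refl , refl)) (inj₁ (refl , refl)) = inj₁ (refl , refl)
joins-samePair _ (inj₁ (refl , refl)) (inj₂ (refl , refl)) = inj₂ (refl , refl)
joins-samePair _ (inj₂ (refl , refl)) (inj₁ (refl , refl)) = inj₂ (refl , refl)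
joins-samePair _ (inj₂ (refl , refl)) (inj₂ (refl , refl)) = inj₁ (refl , refl)

-- Quantifying over all edges that join `u` and `v` avoids choosing an orientation and makes the
-- case `u ≡ v` vacuous, so that no proof of `u ≢ v` has to be carried along.
Fresh : Position n → Fin n → Fin n → Set
Fresh p u v = ∀ e → Joins u v e → e ∉ claimed p

fresh-start : ∀ {u v : Fin n} → Fresh start u v
fresh-start _ _ ()

AdjC : Position n → Fin n → Fin n → Set
AdjC p = Adj (clientGraph p)

_⊑_ : Position n → Position n → Set
p ⊑ p′ = ∀ {u v} → AdjC p u v → AdjC p′ u v

∈-removeAt⁻ : ∀ {A : Set} {k} (xs : Vec A (suc k)) i {x} → x ∈ toList (removeAt xs i) → ∃[ j ] x ≡ Vec.lookup xs j
∈-removeAt⁻ (x ∷ xs)     zero    x∈          = let j , eq = ∈-toList⁻ xs x∈ in suc j , eq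
  where
  ∈-toList⁻ : ∀ {A : Set} {k} (xs : Vec A k) {x} → x ∈ toList xs → ∃[ j ] x ≡ Vec.lookup xs j
  ∈-toList⁻ (x ∷ xs) (here eq)  = zero , eq
  ∈-toList⁻ (x ∷ xs) (there x∈) = let j , eq = ∈-toList⁻ xs x∈ in suc j , eq
∈-removeAt⁻ (x ∷ y ∷ xs) (suc i) (here eq)  = zero , eq
∈-removeAt⁻ (x ∷ y ∷ xs) (suc i) (there x∈) = let j , eq = ∈-removeAt⁻ (y ∷ xs) i x∈ in suc j , eq

-- This is all that later rounds remember of a round. Each invariant below is carried over by `mono`
-- and `fresh` alone.
record Offered {n k : ℕ} (a b : Fin k → Fin n) (p p′ : Position n) : Set where
  field
    chosen : Fin k
    adj    : AdjC p′ (a chosen) (b chosen)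
    mono   : p ⊑ p′
    fresh  : ∀ {u v} → Fresh p u v → (∀ j → ¬ SamePair u v (a j) (b j)) → Fresh p′ u v

offer : ∀ {p : Position n} (a b : Fin (suc q) → Fin n) → (∀ i → a i ≢ b i) →
  (∀ {i j} → SamePair (a i) (b i) (a j) (b j) → i ≡ j) → (∀ i → Fresh p (a i) (b i)) →
  Forces {q = q} (Offered a b p) 1 p
offer {q = q} {p} a b a≢b distinct fresh = step o λ i → done record
  { chosen = i
  ; adj    = here (subst (Joins (a i) (b i)) (sym (Vec.lookup∘tabulate e i)) (joins i))
  ; mono   = there
  ; fresh  = λ {u} {v} → fresh′ i {u} {v}
  }
  where
  e : Fin (suc q) → Edge _
  e i = link (a i) (b i) (a≢b i)
  joins : ∀ i → Joins (a i) (b i) (e i)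
  joins i = joins-link (a i) (b i) (a≢b i)
  o : Offer q p
  o = record
    { edges    = Vec.tabulate e
    ; distinct = VecUnique.tabulate⁺ {f = e} λ {i} {j} eq →
        distinct (joins-samePair (e i) (joins i) (subst (Joins (a j) (b j)) (sym eq) (joins j)))
    ; free     = VecAll.tabulate⁺ {f = e} λ i → ∈-unclaimed⁺ p (fresh i (e i) (joins i))
    }
  not-offered : ∀ {u v} → (∀ j → ¬ SamePair u v (a j) (b j)) →
    ∀ e′ → Joins u v e′ → ¬ (∃[ j ] e′ ≡ Vec.lookup (Vec.tabulate e) j)
  not-offered differs e′ jn (j , eq) = differs j (joins-samePair e′ jn
    (subst (Joins (a j) (b j)) (sym (trans eq (Vec.lookup∘tabulate e j))) (joins j)))
  fresh′ : ∀ i {u v} → Fresh p u v → (∀ j → ¬ SamePair u v (a j) (b j)) → Fresh (claim p o i) u v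
  fresh′ i fr differs e′ jn (here eq) = not-offered differs e′ jn (i , eq)
  fresh′ i fr differs e′ jn (there e∈) with ∈-++⁻ (client p) e∈
  ... | inj₁ e∈c = fr e′ jn (∈-++⁺ˡ e∈c)
  ... | inj₂ e∈w with ∈-++⁻ (toList (removeAt (Vec.tabulate e) i)) e∈w
  ...   | inj₁ e∈r = not-offered differs e′ jn (∈-removeAt⁻ (Vec.tabulate e) i e∈r)
  ...   | inj₂ e∈p = fr e′ jn (∈-++⁺ʳ (client p) e∈p)

Star⟨_⟩ : ∀ {k} → Position n → Fin n → (Fin k → Fin n) → Position n → Set
Star⟨ p ⟩ v xs p′ = Offered (λ _ → v) xs p p′

-- Only the first q + 1 entries of `xs` are offered, but the conclusion gives up the freshness of
-- the whole star, so that callers need not know which entries these are.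
offer-star : ∀ {p : Position n} v {k} (xs : Fin k → Fin n) → Injective _≡_ _≡_ xs → suc q ≤ k →
  (∀ i → v ≢ xs i) → (∀ i → Fresh p v (xs i)) → Forces {q = q} (Star⟨ p ⟩ v xs) 1 p
offer-star {q = q} v xs inj q<k v≢xs unclaimedEdges =
  offer (λ _ → v) ys (λ i → v≢xs _)
    (λ { (inj₁ (_ , eq)) → Fin.inject≤-injective q<k q<k _ _ (inj (sym eq))
       ; (inj₂ (eq , _)) → contradiction eq (v≢xs _) })
    (λ i → unclaimedEdges _)
  >>= λ out → let open Offered out in done record
    { chosen = inject≤ chosen q<k
    ; adj    = adj
    ; mono   = mono
    ; fresh  = λ fr differs → fresh fr λ j → differs (inject≤ j q<k)
    }
  where
  ys : Fin (suc q) → Fin _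
  ys j = xs (inject≤ j q<k)

-- Paths, leaves and chords

module _ {A : Set} where
  _[_↦_] : (ℕ → A) → ℕ → A → ℕ → A
  (f [ k ↦ x ]) i with k ≤? i
  ... | yes _ = x
  ... | no  _ = f i

  ↦-old : ∀ f {k} {x : A} {i} → i < k → (f [ k ↦ x ]) i ≡ f i
  ↦-old f {k} {i = i} i<k with k ≤? i
  ... | yes k≤i = contradiction i<k (ℕ.≤⇒≯ k≤i)
  ... | no  _   = refl

  ↦-new : ∀ f k {x : A} → (f [ k ↦ x ]) k ≡ x
  ↦-new f k with k ≤? k
  ... | yes _  = refl
  ... | no k≰k = contradiction ℕ.≤-refl k≰k

  ↦-elim : ∀ (P : ℕ → A → Set) f {k x} → (∀ {i} → i < k → P i (f i)) → P k x →
    ∀ {i} → i < suc k → P i ((f [ k ↦ x ]) i)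
  ↦-elim P f old new {i} i<1+k with ℕ.m≤n⇒m<n∨m≡n (s≤s⁻¹ i<1+k)
  ... | inj₁ i<k  = subst (P i) (sym (↦-old f i<k)) (old i<k)
  ... | inj₂ refl = subst (P i) (sym (↦-new f i)) new

  ↦-injective : ∀ f {k x} → (∀ {i j} → i < k → j < k → f i ≡ f j → i ≡ j) →
    (∀ {i} → i < k → f i ≢ x) →
    ∀ {i j} → i < suc k → j < suc k → (f [ k ↦ x ]) i ≡ (f [ k ↦ x ]) j → i ≡ j
  ↦-injective f {k} {x} inj f≢x {i} {j} i< j< = ↦-elim (λ i y → y ≡ (f [ k ↦ x ]) j → i ≡ j) f
    (λ {i} i<k → ↦-elim (λ j z → f i ≡ z → i ≡ j) f (inj i<k) (λ eq → contradiction eq (f≢x i<k)) j<)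
    (↦-elim (λ j z → x ≡ z → k ≡ j) f (λ j<k eq → contradiction (sym eq) (f≢x j<k)) (λ _ → refl) j<) i<

-- `I` will be the block of A that holds the path and `J` the block that holds the leaves.
module Cycles {n q : ℕ} (I J : Fin n → Set) (I∩J : ∀ {x} → I x → ¬ J x) where

  -- vertex i is meaningful for i < len only.
  record Path (p : Position n) (len : ℕ) : Set where
    field
      vertex : ℕ → Fin n
      inj    : ∀ {i j} → i < len → j < len → vertex i ≡ vertex j → i ≡ j
      adj    : ∀ {i} → suc i < len → AdjC p (vertex i) (vertex (suc i))
      inI : ∀ {i} → i < len → I (vertex i)

  path-mono : ∀ {p p′ len} → p ⊑ p′ → Path p len → Path p′ len
  path-mono p⊑p′ P = record
    { vertex = vertex ; inj = inj ; adj = λ {i} i< → p⊑p′ {vertex i} {vertex (suc i)} (adj i<) ; inI = inI }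
    where open Path P

  -- All offers so far were made at earlier heads of the path, which is why the edges at the current
  -- head and those within `rest` are still free. `frame` hands the untouched edges on to the later
  -- stages.
  record Growing (len r : ℕ) (p : Position n) : Set where
    field
      path    : Path p (suc len)
      rest    : Fin r → Fin n
    open Path path public
    field
      restInj   : Injective _≡_ _≡_ rest
      restI     : ∀ y → I (rest y)
      unvisited : ∀ {i} → i < suc len → ∀ y → vertex i ≢ rest y
      freshHead : ∀ y → Fresh p (vertex len) (rest y)
      freshRest : ∀ y y′ → Fresh p (rest y) (rest y′)
      frame     : ∀ {u v} → ¬ (I u × I v) → Fresh p u v

  growing-start : ∀ {r} (xs : Fin (suc r) → Fin n) → Injective _≡_ _≡_ xs → (∀ i → I (xs i)) →
    Growing 0 r start
  growing-start xs xs-inj xsI = record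
    { path = record { vertex = λ _ → xs zero ; inj = λ { (s≤s z≤n) (s≤s z≤n) _ → refl }
                    ; adj = λ { (s≤s ()) } ; inI = λ _ → xsI zero }
    ; rest = xs ∘ suc
    ; restInj = Fin.suc-injective ∘ xs-inj
    ; restI = λ y → xsI (suc y)
    ; unvisited = λ _ y eq → case xs-inj eq of λ ()
    ; freshHead = λ y → fresh-start {u = xs zero} {v = xs (suc y)}
    ; freshRest = λ y y′ → fresh-start {u = xs (suc y)} {v = xs (suc y′)}
    ; frame = λ {u} {v} _ → fresh-start {u = u} {v = v}
    }

  grow : ∀ {len r p} → q ≤ r → Growing len (suc r) p → Forces {q = q} (Growing (suc len) r) 1 p
  grow {len} {r} {p} q≤r G =
    offer-star v rest restInj (s≤s q≤r) (unvisited ℕ.≤-refl) freshHead >>= λ out → done (next out)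
    where
    open Growing G
    v = vertex len
    next : ∀ {p′} → Star⟨ p ⟩ v rest p′ → Growing (suc len) r p′
    next {p′} out = record
      { path = record
        { vertex = vertex′
        ; inj = ↦-injective vertex inj (λ i< → unvisited i< chosen)
        ; adj = λ {i} 1+i< → adj′ (s≤s⁻¹ 1+i<)
        ; inI = ↦-elim (λ _ → I) vertex inI (restI chosen)
        }
      ; rest = rest′
      ; restInj = Fin.punchIn-injective chosen _ _ ∘ restInj
      ; restI = λ y → restI (punchIn chosen y)
      ; unvisited = λ i< y → ↦-elim (λ _ x → x ≢ rest′ y) vertex (λ i< → unvisited i< (punchIn chosen y))
          (λ eq → Fin.punchInᵢ≢i chosen y (sym (restInj eq))) i<
      ; freshHead = λ y → subst (λ x → Fresh p′ x (rest′ y)) (sym (↦-new vertex (suc len))) (freshPair _ _)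
      ; freshRest = λ y y′ → freshPair _ _
      ; frame = λ {u} {w} ¬Iuw → fresh {u} {w} (frame ¬Iuw)
          λ { j (inj₁ (refl , refl)) → ¬Iuw (inI ℕ.≤-refl , restI j)
            ; j (inj₂ (refl , refl)) → ¬Iuw (restI j , inI ℕ.≤-refl) }
      }
      where
      open Offered out renaming (adj to adjNew)
      vertex′ = vertex [ suc len ↦ rest chosen ]
      rest′ = rest ∘ punchIn chosen
      freshPair : ∀ y y′ → Fresh p′ (rest y) (rest y′)
      freshPair y y′ = fresh (freshRest y y′)
        λ { j (inj₁ (eq , _)) → unvisited ℕ.≤-refl y eq
          ; j (inj₂ (eq , _)) → unvisited ℕ.≤-refl y′ eq }
      adj′ : ∀ {i} → i < suc len → AdjC p′ (vertex′ i) (vertex′ (suc i))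
      adj′ {i} i< with ℕ.m≤n⇒m<n∨m≡n (s≤s⁻¹ i<)
      ... | inj₁ i<len = subst₂ (AdjC p′) (sym (↦-old vertex i<)) (sym (↦-old vertex (s≤s i<len)))
                           (mono {vertex i} {vertex (suc i)} (adj (s≤s i<len)))
      ... | inj₂ refl  = subst₂ (AdjC p′) (sym (↦-old vertex i<)) (sym (↦-new vertex (suc i))) adjNew

  -- An offer needs q + 1 unvisited vertices, so q of them remain unvisited at the end.
  growPath : ∀ j {len p} → Growing len (j + q) p → Forces {q = q} (Growing (j + len) q) j p
  growPath zero    G = done G
  growPath (suc j) {len} G = grow (ℕ.m≤n+m q j) G >>= λ {p′} G′ →
    subst (λ l → Forces {q = q} (Growing l q) j p′) (ℕ.+-suc j len) (growPath j G′)

  -- Leaf i is chosen before vertex j > i offers any edge to J, so the edges between them stay unclaimed.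
  record Leafing (len c r : ℕ) (p : Position n) : Set where
    field
      path    : Path p len
      leaf    : ℕ → Fin n
      rest    : Fin r → Fin n
    open Path path public
    field
      leafInj   : ∀ {i j} → i < c → j < c → leaf i ≡ leaf j → i ≡ j
      leafJ     : ∀ {i} → i < c → J (leaf i)
      leafAdj   : ∀ {i} → i < c → AdjC p (vertex i) (leaf i)
      leafFresh : ∀ {i} → i < c → ∀ {j} → i < j → j < len → Fresh p (vertex j) (leaf i)
      restInj   : Injective _≡_ _≡_ rest
      restJ     : ∀ y → J (rest y)
      unused    : ∀ {i} → i < c → ∀ y → leaf i ≢ rest y
      freshNext : ∀ {j y} → c ≤ j → j < len → J y → Fresh p (vertex j) y
      frame     : ∀ {u v} → ¬ ((I u ⊎ J u) × (I v ⊎ J v)) → Fresh p u v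

  leafing-start : ∀ {len r₀ r p} (xs : Fin r → Fin n) → Injective _≡_ _≡_ xs → (∀ i → J (xs i)) →
    Growing len r₀ p → Leafing (suc len) 0 r p
  leafing-start xs xs-inj xsJ G = record
    -- There is no leaf yet, so `vertex` merely fills the field.
    { path = path ; leaf = vertex ; rest = xs
    ; leafInj = λ () ; leafJ = λ () ; leafAdj = λ () ; leafFresh = λ ()
    ; restInj = xs-inj ; restJ = xsJ ; unused = λ ()
    ; freshNext = λ _ _ Jy → frame λ (_ , Iy) → I∩J Iy Jy
    ; frame = λ ¬IJ → frame λ (Iu , Iv) → ¬IJ (inj₁ Iu , inj₁ Iv)
    }
    where open Growing G

  growLeaf : ∀ {len c r p} → c < len → q ≤ r → Leafing len c (suc r) p →
    Forces {q = q} (Leafing len (suc c) r) 1 p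
  growLeaf {len} {c} {r} {p} c<len q≤r L =
    offer-star v rest restInj (s≤s q≤r) v≢rest (λ y → freshNext ℕ.≤-refl c<len (restJ y))
    >>= λ out → done (next out)
    where
    open Leafing L
    v = vertex c
    Iv = inI c<len
    v≢rest : ∀ y → v ≢ rest y
    v≢rest y eq = I∩J (subst I eq Iv) (restJ y)
    next : ∀ {p′} → Star⟨ p ⟩ v rest p′ → Leafing len (suc c) r p′
    next {p′} out = record
      { path = path-mono (λ {u} {w} → mono {u} {w}) path
      ; leaf = leaf [ c ↦ rest chosen ]
      ; rest = rest′
      ; leafInj = ↦-injective leaf leafInj (λ i< → unused i< chosen)
      ; leafJ = ↦-elim (λ _ → J) leaf leafJ (restJ chosen)
      ; leafAdj = ↦-elim (λ i x → AdjC p′ (vertex i) x) leaf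
          (λ {i} i<c → mono {vertex i} {leaf i} (leafAdj i<c)) adjNew
      ; leafFresh = ↦-elim (λ i x → ∀ {j} → i < j → j < len → Fresh p′ (vertex j) x) leaf
          (λ i<c i<j j< → fresh (leafFresh i<c i<j j<)
            λ { y (inj₁ (_ , eq)) → unused i<c y (sym eq)
              ; y (inj₂ (eq , _)) → I∩J (subst I eq Iv) (leafJ i<c) })
          (λ c<j j< → later c<j j< (restJ chosen))
      ; restInj = Fin.punchIn-injective chosen _ _ ∘ restInj
      ; restJ = λ y → restJ (punchIn chosen y)
      ; unused = λ i< y → ↦-elim (λ _ x → x ≢ rest′ y) leaf (λ i< → unused i< (punchIn chosen y))
          (λ eq → Fin.punchInᵢ≢i chosen y (sym (restInj eq))) i<
      ; freshNext = later
      ; frame = λ {u} {w} ¬IJ → fresh {u} {w} (frame ¬IJ)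
          λ { j (inj₁ (refl , refl)) → ¬IJ (inj₁ Iv , inj₂ (restJ j))
            ; j (inj₂ (refl , refl)) → ¬IJ (inj₂ (restJ j) , inj₁ Iv) }
      }
      where
      open Offered out renaming (adj to adjNew)
      rest′ = rest ∘ punchIn chosen
      later : ∀ {j y} → suc c ≤ j → j < len → J y → Fresh p′ (vertex j) y
      later c<j j< Jy = fresh (freshNext (ℕ.<⇒≤ c<j) j< Jy)
        λ { y′ (inj₁ (eq , _)) → ℕ.<⇒≢ c<j (inj c<len j< eq)
          ; y′ (inj₂ (eq , _)) → I∩J (subst I eq Iv) Jy }

  growLeaves : ∀ j {len c p} → j + c ≤ len → Leafing len c (j + q) p →
    Forces {q = q} (Leafing len (j + c) q) j p
  growLeaves zero    _ L = done L
  growLeaves (suc j) {len} {c} le L =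
    growLeaf (ℕ.≤-trans (s≤s (ℕ.m≤n+m c j)) le) (ℕ.m≤n+m q j) L >>= λ {p′} L′ →
    subst (λ c′ → Forces {q = q} (Leafing len c′ q) j p′) (ℕ.+-suc j c)
      (growLeaves j (subst (_≤ len) (sym (ℕ.+-suc j c)) le) L′)

  -- A chord vertex (i + s) – leaf i closes a cycle of length s + 2.
  record Chords (len s : ℕ) (p : Position n) : Set where
    field
      path    : Path p len
      leaf    : ℕ → Fin n
    open Path path public
    field
      leafInj    : ∀ {i j} → i < suc q → j < suc q → leaf i ≡ leaf j → i ≡ j
      leafJ      : ∀ {i} → i < suc q → J (leaf i)
      leafAdj    : ∀ {i} → i < suc q → AdjC p (vertex i) (leaf i)
      chord      : ∀ {t} → 1 ≤ t → t < s → ∃[ i ] (i < suc q × AdjC p (vertex (i + t)) (leaf i))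
      freshChord : ∀ {t i} → s ≤ t → i < suc q → i + t < len → Fresh p (vertex (i + t)) (leaf i)
      frame      : ∀ {u v} → ¬ ((I u ⊎ J u) × (I v ⊎ J v)) → Fresh p u v

  chords-start : ∀ {len r p} → Leafing len (suc q) r p → Chords len 1 p
  chords-start L = record
    { path = path ; leaf = leaf ; leafInj = leafInj ; leafJ = leafJ ; leafAdj = leafAdj
    ; chord = λ 1≤t t<1 → contradiction 1≤t (ℕ.<⇒≱ t<1)
    ; freshChord = λ {t} {i} 1≤t i< → leafFresh i< (ℕ.m<m+n i 1≤t)
    ; frame = frame
    }
    where open Leafing L

  growChord : ∀ {len s p} → q + s < len → Chords len s p → Forces {q = q} (Chords len (suc s)) 1 p
  growChord {len} {s} {p} q+s< C = offer (λ i → vertex (toℕ i + s)) (λ i → leaf (toℕ i))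
    (λ i eq → I∩J (subst I eq (inI (bound i))) (leafJ (Fin.toℕ<n i)))
    (λ { {i} {j} (inj₁ (_ , eq)) → Fin.toℕ-injective (leafInj (Fin.toℕ<n i) (Fin.toℕ<n j) (sym eq))
       ; {i} {j} (inj₂ (eq , _)) → contradiction (leafJ (Fin.toℕ<n i)) (I∩J (subst I eq (inI (bound j)))) })
    (λ i → freshChord ℕ.≤-refl (Fin.toℕ<n i) (bound i))
    >>= λ out → done (next out)
    where
    open Chords C
    bound : ∀ (i : Fin (suc q)) → toℕ i + s < len
    bound i = ℕ.≤-<-trans (ℕ.+-monoˡ-≤ s (s≤s⁻¹ (Fin.toℕ<n i))) q+s<
    next : ∀ {p′} → Offered (λ i → vertex (toℕ {suc q} i + s)) (λ i → leaf (toℕ i)) p p′ → Chords len (suc s) p′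
    next {p′} out = record
      { path = path-mono (λ {u} {w} → mono {u} {w}) path
      ; leaf = leaf ; leafInj = leafInj ; leafJ = leafJ
      ; leafAdj = λ {i} i< → mono {vertex i} {leaf i} (leafAdj i<)
      ; chord = chord′
      ; freshChord = λ {t} {i} s<t i< i+t< → fresh (freshChord (ℕ.<⇒≤ s<t) i< i+t<)
          -- Equal leaves force the indices j and i to agree; the path would then repeat a vertex at
          -- the distinct positions i + s and i + t.
          λ { j (inj₁ (eq , eq′)) → ℕ.<⇒≢ (ℕ.+-monoʳ-< i s<t)
                (trans (cong (_+ s) (sym (leafInj (Fin.toℕ<n j) i< eq′))) (inj (bound j) i+t< eq))
            ; j (inj₂ (eq , _)) → I∩J (subst I eq (inI (bound j))) (leafJ i<) }
      ; frame = λ {u} {w} ¬IJ → fresh {u} {w} (frame ¬IJ)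
          λ { j (inj₁ (refl , refl)) → ¬IJ (inj₁ (inI (bound j)) , inj₂ (leafJ (Fin.toℕ<n j)))
            ; j (inj₂ (refl , refl)) → ¬IJ (inj₂ (leafJ (Fin.toℕ<n j)) , inj₁ (inI (bound j))) }
      }
      where
      open Offered out renaming (adj to adjNew)
      chord′ : ∀ {t} → 1 ≤ t → t < suc s → ∃[ i ] (i < suc q × AdjC p′ (vertex (i + t)) (leaf i))
      chord′ 1≤t t<1+s with ℕ.m≤n⇒m<n∨m≡n (s≤s⁻¹ t<1+s)
      ... | inj₁ t<s = let i , i< , adj = chord 1≤t t<s in
                       i , i< , mono {vertex _} {leaf i} adj
      ... | inj₂ refl = toℕ chosen , Fin.toℕ<n chosen , adjNew

  growChords : ∀ j {len s p} → q + (j + s) ≤ len → Chords len s p → Forces {q = q} (Chords len (j + s)) j p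
  growChords zero    _ C = done C
  growChords (suc j) {len} {s} le C =
    growChord (ℕ.≤-trans (s≤s (ℕ.+-monoʳ-≤ q (ℕ.m≤n+m s j))) (subst (_≤ len) (ℕ.+-suc q (j + s)) le)) C
    >>= λ {p′} C′ → subst (λ s′ → Forces {q = q} (Chords len s′) j p′) (ℕ.+-suc j s)
      (growChords j (subst (λ s′ → q + s′ ≤ len) (sym (ℕ.+-suc j s)) le) C′)

  -- The rounds are ℓ for the path, q + 1 for the leaves and s for the chords of offsets 1 to s.
  -- Both `xs` and `ys` contain q spare vertices, which the last offer of their stage needs.
  forceChords : ∀ ℓ s (xs : Fin (suc (ℓ + q)) → Fin n) → Injective _≡_ _≡_ xs → (∀ i → I (xs i)) →
    (ys : Fin (suc q + q) → Fin n) → Injective _≡_ _≡_ ys → (∀ i → J (ys i)) →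
    suc q ≤ suc ℓ → q + (s + 1) ≤ suc ℓ →
    Forces {q = q} (Chords (suc ℓ) (s + 1)) (ℓ + (suc q + s)) start
  forceChords ℓ s xs xs-inj xsI ys ys-inj ysJ q≤ℓ s≤ℓ =
    growPath ℓ (growing-start xs xs-inj xsI) >>= λ G →
    growLeaves (suc q) (subst₂ _≤_ (sym (ℕ.+-identityʳ _)) (cong suc (sym (ℕ.+-identityʳ ℓ))) q≤ℓ)
      (leafing-start ys ys-inj ysJ G) >>= λ {p} L →
    growChords s s≤ℓ (subst (λ l → Chords l 1 p) (cong suc (ℕ.+-identityʳ ℓ))
      (chords-start (subst (λ c → Leafing (suc (ℓ + 0)) c q p) (ℕ.+-identityʳ (suc q)) L)))

  chords⇒cycle : ∀ {len s p t} → q + s ≤ len → Chords len s p → 1 ≤ t → t < s →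
    Cycle (clientGraph p) (suc (suc t))
  chords⇒cycle {len} {s} {p} {t} q+s≤ C 1≤t t<s = record
    { 3≤k      = s≤s (s≤s 1≤t)
    ; vertex   = λ j → walk (toℕ j)
    ; distinct = λ {j} {j′} → Fin.toℕ-injective ∘ walk-inj (Fin.toℕ<n j) (Fin.toℕ<n j′)
    ; adjacent = λ j j′ → walk-adj (Fin.toℕ<n j) (Fin.toℕ<n j′)
    }
    where
    open Chords C
    i  = proj₁ (chord 1≤t t<s)
    i< = proj₁ (proj₂ (chord 1≤t t<s))
    closing : AdjC p (vertex (i + t)) (leaf i)
    closing = proj₂ (proj₂ (chord 1≤t t<s))
    -- The cycle starts at the leaf, follows the path from vertex i to vertex i + t and returns
    -- along the chord.
    walk : ℕ → Fin n
    walk zero    = leaf i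
    walk (suc j) = vertex (i + j)
    bound : ∀ {j} → suc j < suc (suc t) → i + j < len
    bound {j} (s≤s (s≤s j≤t)) = ℕ.≤-trans (s≤s (ℕ.+-mono-≤ (s≤s⁻¹ i<) j≤t))
      (ℕ.≤-trans (ℕ.≤-reflexive (sym (ℕ.+-suc q t))) (ℕ.≤-trans (ℕ.+-monoʳ-≤ q t<s) q+s≤))
    walk-inj : ∀ {j j′} → j < suc (suc t) → j′ < suc (suc t) → walk j ≡ walk j′ → j ≡ j′
    walk-inj {zero}  {zero}   _  _  _  = refl
    walk-inj {zero}  {suc j′} _  j′< eq = contradiction (leafJ i<) (I∩J (subst I (sym eq) (inI (bound j′<))))
    walk-inj {suc j} {zero}   j< _  eq = contradiction (leafJ i<) (I∩J (subst I eq (inI (bound j<))))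
    walk-inj {suc j} {suc j′} j< j′< eq = cong suc (ℕ.+-cancelˡ-≡ i j j′ (inj (bound j<) (bound j′<) eq))
    walk-adj : ∀ {j j′} → j < suc (suc t) → j′ < suc (suc t) →
      (j′ ≡ suc j) ⊎ (suc j ≡ suc (suc t) × j′ ≡ 0) → AdjC p (walk j) (walk j′)
    walk-adj {zero} _ _ (inj₁ refl) = subst (λ i′ → AdjC p (leaf i) (vertex i′)) (sym (ℕ.+-identityʳ i))
      (symm (clientGraph p) {vertex i} {leaf i} (leafAdj i<))
    walk-adj {suc j} _ j′< (inj₁ refl) = subst (λ i′ → AdjC p (vertex (i + j)) (vertex i′)) (sym (ℕ.+-suc i j))
      (adj (subst (_< len) (ℕ.+-suc i j) (bound j′<)))
    walk-adj _ _ (inj₂ (refl , refl)) = closing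

-- The potential

∑ : ∀ {A : Set} → List A → (A → ℕ) → ℕ
∑ xs f = sum (map f xs)

module _ {A : Set} where

  ∑-mono : ∀ (xs : List A) {f g} → (∀ x → f x ≤ g x) → ∑ xs f ≤ ∑ xs g
  ∑-mono []       f≤g = z≤n
  ∑-mono (x ∷ xs) f≤g = ℕ.+-mono-≤ (f≤g x) (∑-mono xs f≤g)

  ∑-+ : ∀ (xs : List A) f g → ∑ xs (λ x → f x + g x) ≡ ∑ xs f + ∑ xs g
  ∑-+ []       f g = refl
  ∑-+ (x ∷ xs) f g = trans (cong (λ z → f x + g x + z) (∑-+ xs f g)) (interchange (f x) (g x) (∑ xs f) (∑ xs g))
    where
    interchange : ∀ a b c d → a + b + (c + d) ≡ a + c + (b + d)
    interchange = solve-∀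

  ∑-* : ∀ (xs : List A) k f → ∑ xs (λ x → k * f x) ≡ k * ∑ xs f
  ∑-* []       k f = sym (ℕ.*-zeroʳ k)
  ∑-* (x ∷ xs) k f = trans (cong (λ z → k * f x + z) (∑-* xs k f)) (sym (ℕ.*-distribˡ-+ k (f x) _))

  ∑-cong : ∀ (xs : List A) {f g} → (∀ x → f x ≡ g x) → ∑ xs f ≡ ∑ xs g
  ∑-cong []       f≡g = refl
  ∑-cong (x ∷ xs) f≡g = cong₂ _+_ (f≡g x) (∑-cong xs f≡g)

  ∑-zero : ∀ (xs : List A) → ∑ xs (λ _ → 0) ≡ 0
  ∑-zero []       = refl
  ∑-zero (x ∷ xs) = ∑-zero xs

  ∑-filter : ∀ {P : A → Set} (P? : Decidable P) xs f →
    ∑ (filter P? xs) f ≡ ∑ xs (λ x → if does (P? x) then f x else 0)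
  ∑-filter P? []       f = refl
  ∑-filter P? (x ∷ xs) f with does (P? x)
  ... | true  = cong (λ z → f x + z) (∑-filter P? xs f)
  ... | false = ∑-filter P? xs f

  ∑-indicator : ∀ {P : A → Set} (P? : Decidable P) xs w →
    ∑ xs (λ x → if does (P? x) then w else 0) ≡ length (filter P? xs) * w
  ∑-indicator P? []       w = refl
  ∑-indicator P? (x ∷ xs) w with does (P? x)
  ... | true  = cong (λ z → w + z) (∑-indicator P? xs w)
  ... | false = ∑-indicator P? xs w

  ∑-bound : ∀ (xs : List A) f {b} → (∀ {x} → x ∈ xs → f x ≤ b) → ∑ xs f ≤ length xs * b
  ∑-bound []       f f≤b = z≤n
  ∑-bound (x ∷ xs) f f≤b = ℕ.+-mono-≤ (f≤b (here refl)) (∑-bound xs f (f≤b ∘ there))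

  markov : ∀ {P : A → Set} (P? : Decidable P) f c xs → (∀ {x} → P x → c ≤ f x) →
    length (filter P? xs) * c ≤ ∑ xs f
  markov P? f c xs c≤f = ℕ.≤-trans (ℕ.≤-reflexive (sym (∑-indicator P? xs c))) (∑-mono xs pointwise)
    where
    pointwise : ∀ x → (if does (P? x) then c else 0) ≤ f x
    pointwise x with P? x
    ... | yes Px = c≤f Px
    ... | no  _  = z≤n

∑-swap : ∀ {A B : Set} (xs : List A) (ys : List B) (f : A → B → ℕ) →
  ∑ xs (λ x → ∑ ys (f x)) ≡ ∑ ys (λ y → ∑ xs (λ x → f x y))
∑-swap []       ys f = sym (∑-zero ys)
∑-swap (x ∷ xs) ys f = trans (cong (λ z → ∑ ys (f x) + z) (∑-swap xs ys f))
  (sym (∑-+ ys (f x) (λ y → ∑ xs (λ x → f x y))))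

unique-⊆⇒length≤ : ∀ {n} {xs : List (Fin n)} U → Unique xs → All (Subset._∈ U) xs → length xs ≤ ∣ U ∣
unique-⊆⇒length≤ U AllPairs.[] _ = z≤n
unique-⊆⇒length≤ {xs = x ∷ xs} U (x∉ AllPairs.∷ uniq) (x∈U ∷ xs⊆U) = ℕ.≤-trans
  (s≤s (unique-⊆⇒length≤ (U Subset.- x) uniq
    (All.zipWith (λ (x≢y , y∈U) → Subset.x∈p∧x≢y⇒x∈p-y y∈U (x≢y ∘ sym)) (x∉ , xs⊆U))))
  (Subset.x∈p⇒∣p-x∣<∣p∣ x∈U)

-- `others` retains everything that is not picked, including elements that fail `P`. A bad edge may
-- be good in a later round, and exactly k elements are lost.
record Selection {A : Set} (P : A → Set) (k : ℕ) (xs : List A) : Set where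
  field
    pick       : Fin k → A
    others     : List A
    size       : k + length others ≡ length xs
    pick-inj   : Injective _≡_ _≡_ pick
    pick-P     : ∀ i → P (pick i)
    pick-∈     : ∀ i → pick i ∈ xs
    others-⊆   : others ⊆ xs
    others-uniq : Unique others
    separate   : ∀ i {y} → y ∈ others → pick i ≢ y

select : ∀ {A : Set} {P : A → Set} (P? : Decidable P) k {xs} → Unique xs →
  k + length (filter (¬? ∘ P?) xs) ≤ length xs → Selection P k xs
select P? zero {xs} uniq _ = record
  { pick = λ () ; others = xs ; size = refl ; pick-inj = λ { {()} } ; pick-P = λ () ; pick-∈ = λ ()
  ; others-⊆ = id ; others-uniq = uniq ; separate = λ () }
select {A} {P} P? (suc k) {x ∷ xs} (x∉ AllPairs.∷ uniq) le with P? x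
... | yes Px = record
  { pick = pick′ ; others = others ; size = cong suc size ; pick-inj = inj _ _
  ; pick-P = λ { zero → Px ; (suc i) → pick-P i }
  ; pick-∈ = λ { zero → here refl ; (suc i) → there (pick-∈ i) }
  ; others-⊆ = there ∘ others-⊆ ; others-uniq = others-uniq
  ; separate = λ { zero y∈ → All.lookup x∉ (others-⊆ y∈) ; (suc i) → separate i } }
  where
  open Selection (select P? k uniq (s≤s⁻¹ le))
  pick′ : Fin (suc k) → A
  pick′ zero    = x
  pick′ (suc i) = pick i
  inj : ∀ i j → pick′ i ≡ pick′ j → i ≡ j
  inj zero    zero    _  = refl
  inj zero    (suc j) eq = contradiction eq (All.lookup x∉ (pick-∈ j))
  inj (suc i) zero    eq = contradiction (sym eq) (All.lookup x∉ (pick-∈ i))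
  inj (suc i) (suc j) eq = cong suc (pick-inj eq)
... | no _ = record
  { pick = pick ; others = x ∷ others ; size = trans (cong suc (ℕ.+-suc k _)) (cong suc size)
  ; pick-inj = pick-inj ; pick-P = pick-P
  ; pick-∈ = there ∘ pick-∈
  ; others-⊆ = λ { (here refl) → here refl ; (there y∈) → there (others-⊆ y∈) }
  ; others-uniq = All.tabulate (All.lookup x∉ ∘ others-⊆) AllPairs.∷ others-uniq
  ; separate = λ { i (here refl) eq → All.lookup x∉ (pick-∈ i) (sym eq) ; i (there y∈) → separate i y∈ } }
  where
  open Selection (select P? (suc k) uniq (s≤s⁻¹ (subst (_≤ suc (length xs)) (cong suc (ℕ.+-suc k _)) le)))

-- The event (S , U) is that all edges claimed on behalf of a vertex of S end in U.
Event : ℕ → Set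
Event n = Subset n × Subset n

module Potential {n : ℕ} (m : ℕ) where

  -- Weights are scaled by powers of m, a lower bound on the number of available edges at a vertex:
  -- such an edge ends in U with probability at most ∣ U ∣ / m, and the 2 pays for avoiding bad edges.
  factor : Fin n → Event n → ℕ
  factor v (S , U) = if does (v ∈? S) then 2 * ∣ U ∣ else m

  weight : List (Fin n) → Event n → ℕ
  weight []       e = 1
  weight (v ∷ vs) e = factor v e * weight vs e

  Φ : List (Fin n) → List (Event n) → ℕ
  Φ vs E = ∑ E (weight vs)

  Compatible : Fin n → Fin n → Event n → Set
  Compatible v x (S , U) = (v Subset.∉ S) ⊎ (x Subset.∈ U)

  compatible? : ∀ v x → Decidable (Compatible v x)
  compatible? v x (S , U) = ¬? (v ∈? S) ⊎-dec (x ∈? U)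

  survivors : Fin n → Fin n → List (Event n) → List (Event n)
  survivors v x = filter (compatible? v x)

  module _ (v : Fin n) (vs : List (Fin n)) where
    private
      w = weight vs

    -- The weight of the events that v does not concern, and of those that it does; hit x is the part
    -- of the latter that survives if v is joined to x.
    cold hot : Event n → ℕ
    cold e@(S , U) = if does (v ∈? S) then 0 else w e
    hot  e@(S , U) = if does (v ∈? S) then ∣ U ∣ * w e else 0

    hit : Fin n → Event n → ℕ
    hit x e@(S , U) = if does (v ∈? S) then (if does (x ∈? U) then w e else 0) else 0

    Φ-survivors : ∀ x E → Φ vs (survivors v x E) ≡ ∑ E cold + ∑ E (hit x)
    Φ-survivors x E = trans (∑-filter (compatible? v x) E w)
      (trans (∑-cong E split) (∑-+ E cold (hit x)))
      where
      split : ∀ e → (if does (compatible? v x e) then w e else 0) ≡ cold e + hit x e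
      split (S , U) with does (v ∈? S) | does (x ∈? U)
      ... | true  | true  = refl
      ... | true  | false = refl
      ... | false | _     = sym (ℕ.+-identityʳ _)

    Φ-∷ : ∀ E → Φ (v ∷ vs) E ≡ m * ∑ E cold + 2 * ∑ E hot
    Φ-∷ E = trans (∑-cong E split) (trans (∑-+ E _ _) (cong₂ _+_ (∑-* E m cold) (∑-* E 2 hot)))
      where
      split : ∀ e → factor v e * w e ≡ m * cold e + 2 * hot e
      split e@(S , U) with does (v ∈? S)
      ... | true  = trans (ℕ.*-assoc 2 ∣ U ∣ (w e)) (cong (_+ 2 * (∣ U ∣ * w e)) (sym (ℕ.*-zeroʳ m)))
      ... | false = sym (ℕ.+-identityʳ _)

    -- Double counting: an event that concerns `v` survives for at most ∣U∣ of the vertices x.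
    ∑-hit≤hot : ∀ {xs} → Unique xs → ∀ E → ∑ xs (λ x → ∑ E (hit x)) ≤ ∑ E hot
    ∑-hit≤hot {xs} uniq E = ℕ.≤-trans (ℕ.≤-reflexive (∑-swap xs E hit)) (∑-mono E pointwise)
      where
      pointwise : ∀ e → ∑ xs (λ x → hit x e) ≤ hot e
      pointwise e@(S , U) with does (v ∈? S)
      ... | true  = ℕ.≤-trans (ℕ.≤-reflexive (∑-indicator (_∈? U) xs (w e)))
                      (ℕ.*-monoˡ-≤ (w e) (unique-⊆⇒length≤ U (Unique.filter⁺ (_∈? U) uniq) (All.all-filter (_∈? U) xs)))
      ... | false = ℕ.≤-reflexive (∑-zero xs)

    -- The threshold is twice the average of `hit` if m vertices share the total ∑ `hot`. Its 2 is
    -- the one in `factor`.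
    Good : List (Event n) → Fin n → Set
    Good E x = m * ∑ E (hit x) ≤ 2 * ∑ E hot

    good? : ∀ E → Decidable (Good E)
    good? E x = m * ∑ E (hit x) ≤? 2 * ∑ E hot

    -- An edge at `v` strips one factor from every weight: m from a cold event, 2∣U∣ from a hot one.
    -- For a good `x` the surviving hot weight, scaled by m, is covered by what the hot events had
    -- before, so the bound persists with one power of m less.
    good-descends : ∀ E {x} → Good E x → Φ (v ∷ vs) E < m ^ length (v ∷ vs) →
      Φ vs (survivors v x E) < m ^ length vs
    good-descends E {x} good Φ< = ℕ.*-cancelˡ-< m _ _ (ℕ.≤-<-trans (begin
      m * Φ vs (survivors v x E)         ≡⟨ cong (m *_) (Φ-survivors x E) ⟩
      m * (∑ E cold + ∑ E (hit x))       ≡⟨ ℕ.*-distribˡ-+ m (∑ E cold) (∑ E (hit x)) ⟩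
      m * ∑ E cold + m * ∑ E (hit x)     ≤⟨ ℕ.+-monoʳ-≤ _ good ⟩
      m * ∑ E cold + 2 * ∑ E hot         ≡⟨ Φ-∷ E ⟨
      Φ (v ∷ vs) E                       ∎) Φ<)
      where open ℕ.≤-Reasoning

    -- By integrality a bad vertex exceeds the threshold by at least 1. This extra 1 keeps Markov's
    -- inequality effective when the hot weight is 0.
    2*bad≤m : ∀ {xs} → Unique xs → ∀ E → 2 * length (filter (¬? ∘ good? E) xs) ≤ m
    2*bad≤m {xs} uniq E = bound (length (filter (¬? ∘ good? E) xs)) (∑ E hot) (begin
      length (filter (¬? ∘ good? E) xs) * suc (2 * ∑ E hot)  ≤⟨ markov (¬? ∘ good? E) _ _ xs ℕ.≰⇒> ⟩
      ∑ xs (λ x → m * ∑ E (hit x))                            ≡⟨ ∑-* xs m _ ⟩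
      m * ∑ xs (λ x → ∑ E (hit x))                            ≤⟨ ℕ.*-monoʳ-≤ m (∑-hit≤hot uniq E) ⟩
      m * ∑ E hot                                             ∎)
      where
      open ℕ.≤-Reasoning
      rearrange : ∀ b h → b * suc (2 * h) ≡ b + 2 * b * h
      rearrange = solve-∀
      bound : ∀ b h → b * suc (2 * h) ≤ m * h → 2 * b ≤ m
      bound zero      h le = z≤n
      bound b@(suc _) h le = ℕ.≮⇒≥ λ m<2b → ℕ.<⇒≱ {m * h} {b * suc (2 * h)}
        (ℕ.≤-<-trans (ℕ.*-monoˡ-≤ h (ℕ.<⇒≤ m<2b)) (subst (2 * b * h <_) (sym (rearrange b h)) (ℕ.m<n+m (2 * b * h) {b} (s≤s z≤n)))) le

    select-good : ∀ k {xs} → Unique xs → 2 * k ≤ m → m ≤ length xs → ∀ E → Selection (Good E) k xs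
    select-good k {xs} uniq 2k≤m m≤ E = select (good? E) k uniq (ℕ.≤-trans (ℕ.*-cancelˡ-≤ 2 (begin
      2 * (k + b)     ≡⟨ ℕ.*-distribˡ-+ 2 k b ⟩
      2 * k + 2 * b   ≤⟨ ℕ.+-mono-≤ 2k≤m (2*bad≤m uniq E) ⟩
      m + m           ≡⟨ cong (λ z → m + z) (ℕ.+-identityʳ m) ⟨
      2 * m           ∎)) m≤)
      where
      open ℕ.≤-Reasoning
      b = length (filter (¬? ∘ good? E) xs)

-- The initial potential

∑-++ : ∀ {A : Set} (xs ys : List A) f → ∑ (xs ++ ys) f ≡ ∑ xs f + ∑ ys f
∑-++ xs ys f = trans (cong sum (List.map-++ f xs ys)) (sum-++ (map f xs) (map f ys))

-- e^x ≤ 1 + x + x² for x = j / m ≤ 1.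
[1+m]^j*m²≤ : ∀ m j → j ≤ m → suc m ^ j * (m * m) ≤ m ^ j * (m * m + j * m + j * j)
[1+m]^j*m²≤ m zero _ = ℕ.≤-reflexive (cong (_+ 0) (trans (sym (ℕ.+-identityʳ _)) (sym (ℕ.+-identityʳ _))))
[1+m]^j*m²≤ m (suc j) j<m = begin
  suc m * suc m ^ j * (m * m)                                ≡⟨ ℕ.*-assoc (suc m) (suc m ^ j) _ ⟩
  suc m * (suc m ^ j * (m * m))                              ≤⟨ ℕ.*-monoʳ-≤ (suc m) ([1+m]^j*m²≤ m j (ℕ.<⇒≤ j<m)) ⟩
  suc m * (m ^ j * (m * m + j * m + j * j))                  ≡⟨ lhs m j (m ^ j) ⟩
  m ^ j * (common + j * j)                                   ≤⟨ ℕ.*-monoʳ-≤ (m ^ j) (ℕ.+-monoʳ-≤ common j²≤) ⟩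
  m ^ j * (common + (j * m + m))                             ≡⟨ rhs m j (m ^ j) ⟩
  m * m ^ j * (m * m + suc j * m + suc j * suc j)            ∎
  where
  open ℕ.≤-Reasoning
  common = m * m * m + j * m * m + j * j * m + m * m + j * m
  lhs : ∀ m j x → suc m * (x * (m * m + j * m + j * j)) ≡ x * (m * m * m + j * m * m + j * j * m + m * m + j * m + j * j)
  lhs = solve-∀
  rhs : ∀ m j x → x * (m * m * m + j * m * m + j * j * m + m * m + j * m + (j * m + m))
                ≡ m * x * (m * m + suc j * m + suc j * suc j)
  rhs = solve-∀
  j²≤ : j * j ≤ j * m + m
  j²≤ = ℕ.≤-trans (ℕ.*-monoʳ-≤ j (ℕ.<⇒≤ j<m)) (ℕ.m≤m+n _ m)

-- The preceding estimate at x = 1, where 1 + x + x² is 3; it replaces the constant e in the bound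
-- on binomial coefficients.
[1+m]^m≤3*m^m : ∀ m → suc m ^ m ≤ 3 * m ^ m
[1+m]^m≤3*m^m zero = s≤s z≤n
[1+m]^m≤3*m^m m@(suc _) = ℕ.*-cancelʳ-≤ _ _ (m * m)
  (ℕ.≤-trans ([1+m]^j*m²≤ m m ℕ.≤-refl) (ℕ.≤-reflexive (rearrange m (m ^ m))))
  where
  rearrange : ∀ m x → x * (m * m + m * m + m * m) ≡ 3 * x * (m * m)
  rearrange = solve-∀

^-distribʳ-* : ∀ k m n → (m * n) ^ k ≡ m ^ k * n ^ k
^-distribʳ-* zero    m n = refl
^-distribʳ-* (suc k) m n = trans (cong (m * n *_) (^-distribʳ-* k m n)) (interchange m n (m ^ k) (n ^ k))
  where
  interchange : ∀ m n x y → m * n * (x * y) ≡ m * x * (n * y)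
  interchange = solve-∀

bernoulli : ∀ n u → n ^ suc u + suc u * n ^ u ≤ suc n ^ suc u
bernoulli n zero    = ℕ.≤-reflexive (identity n)
  where
  identity : ∀ n → n * 1 + 1 ≡ 1 + n * 1
  identity = solve-∀
bernoulli n (suc u) = begin
  n * (n * x) + suc (suc u) * (n * x)                   ≤⟨ ℕ.m≤m+n _ (suc u * x) ⟩
  n * (n * x) + suc (suc u) * (n * x) + suc u * x       ≡⟨ rearrange n u x ⟩
  suc n * (n * x + suc u * x)                           ≤⟨ ℕ.*-monoʳ-≤ (suc n) (bernoulli n u) ⟩
  suc n * suc n ^ suc u                                 ∎
  where
  open ℕ.≤-Reasoning
  x = n ^ u
  rearrange : ∀ n u x → n * (n * x) + suc (suc u) * (n * x) + suc u * x ≡ suc n * (n * x + suc u * x)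
  rearrange = solve-∀

-- Counting subsets and events

subsetsOfSize : ∀ n → ℕ → List (Subset n)
subsetsOfSize zero    zero    = [] ∷ []
subsetsOfSize zero    (suc u) = []
subsetsOfSize (suc n) zero    = map (outside ∷_) (subsetsOfSize n zero)
subsetsOfSize (suc n) (suc u) = map (inside ∷_) (subsetsOfSize n u) ++ map (outside ∷_) (subsetsOfSize n (suc u))

∈-subsetsOfSize⁺ : ∀ {n} (U : Subset n) → U ∈ subsetsOfSize n ∣ U ∣
∈-subsetsOfSize⁺ []            = here refl
∈-subsetsOfSize⁺ (inside ∷ U)  = ∈-++⁺ˡ (∈-map⁺ (inside ∷_) (∈-subsetsOfSize⁺ U))
∈-subsetsOfSize⁺ {suc n} (outside ∷ U) with ∣ U ∣ | ∈-subsetsOfSize⁺ U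
... | zero  | U∈ = ∈-map⁺ (outside ∷_) U∈
... | suc u | U∈ = ∈-++⁺ʳ (map (inside ∷_) (subsetsOfSize n u)) (∈-map⁺ (outside ∷_) U∈)

∈-subsetsOfSize⁻ : ∀ n u {U} → U ∈ subsetsOfSize n u → ∣ U ∣ ≡ u
∈-subsetsOfSize⁻ zero    zero    (here refl) = refl
∈-subsetsOfSize⁻ (suc n) zero    U∈ with ∈-map⁻ (outside ∷_) U∈
... | _ , U∈′ , refl = ∈-subsetsOfSize⁻ n zero U∈′
∈-subsetsOfSize⁻ (suc n) (suc u) U∈ with ∈-++⁻ (map (inside ∷_) (subsetsOfSize n u)) U∈
... | inj₁ U∈ˡ with ∈-map⁻ (inside ∷_) U∈ˡ
...   | _ , U∈′ , refl = cong suc (∈-subsetsOfSize⁻ n u U∈′)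
∈-subsetsOfSize⁻ (suc n) (suc u) U∈ | inj₂ U∈ʳ with ∈-map⁻ (outside ∷_) U∈ʳ
...   | _ , U∈′ , refl = ∈-subsetsOfSize⁻ n (suc u) U∈′

-- The classical bound (en/u)^u on a binomial coefficient, with 3 for e, by induction along Pascal's
-- rule. Passing from u^u to (u + 1)^u costs a factor 3, and `bernoulli` recombines the two summands
-- into a power of n + 1.
length-subsetsOfSize : ∀ n u → length (subsetsOfSize n u) * u ^ u ≤ (3 * n) ^ u
length-subsetsOfSize zero    zero    = s≤s z≤n
length-subsetsOfSize zero    (suc u) = z≤n
length-subsetsOfSize (suc n) zero    = subst (λ l → l * 1 ≤ 1) (sym (List.length-map (outside ∷_) (subsetsOfSize n zero))) (length-subsetsOfSize n zero)
length-subsetsOfSize (suc n) (suc u) = begin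
  length (map (inside ∷_) (subsetsOfSize n u) ++ map (outside ∷_) (subsetsOfSize n (suc u))) * suc u ^ suc u
    ≡⟨ cong (_* suc u ^ suc u) (trans (List.length-++ (map (inside ∷_) (subsetsOfSize n u))) (cong₂ _+_ (List.length-map _ (subsetsOfSize n u)) (List.length-map _ (subsetsOfSize n (suc u))))) ⟩
  (a + b) * (suc u * suc u ^ u)
    ≡⟨ expand a b (suc u) (suc u ^ u) ⟩
  suc u * (a * suc u ^ u) + b * suc u ^ suc u
    ≤⟨ ℕ.+-mono-≤ (ℕ.*-monoʳ-≤ (suc u) first) (length-subsetsOfSize n (suc u)) ⟩
  suc u * (3 * (3 * n) ^ u) + (3 * n) ^ suc u
    ≡⟨ cong₂ (λ x y → suc u * (3 * x) + y) (^-distribʳ-* u 3 n) (^-distribʳ-* (suc u) 3 n) ⟩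
  suc u * (3 * (3 ^ u * n ^ u)) + 3 * 3 ^ u * (n * n ^ u)
    ≡⟨ collect (suc u) (3 ^ u) n (n ^ u) ⟩
  3 * 3 ^ u * (n * n ^ u + suc u * n ^ u)
    ≤⟨ ℕ.*-monoʳ-≤ (3 * 3 ^ u) (bernoulli n u) ⟩
  3 ^ suc u * suc n ^ suc u
    ≡⟨ ^-distribʳ-* (suc u) 3 (suc n) ⟨
  (3 * suc n) ^ suc u ∎
  where
  open ℕ.≤-Reasoning
  a = length (subsetsOfSize n u)
  b = length (subsetsOfSize n (suc u))
  expand : ∀ a b v x → (a + b) * (v * x) ≡ v * (a * x) + b * (v * x)
  expand = solve-∀
  collect : ∀ v x n y → v * (3 * (x * y)) + 3 * x * (n * y) ≡ 3 * x * (n * y + v * y)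
  collect = solve-∀
  swap3 : ∀ a x → a * (3 * x) ≡ 3 * (a * x)
  swap3 = solve-∀
  first : a * suc u ^ u ≤ 3 * (3 * n) ^ u
  first = ℕ.≤-trans (ℕ.*-monoʳ-≤ a ([1+m]^m≤3*m^m u))
    (ℕ.≤-trans (ℕ.≤-reflexive (swap3 a (u ^ u))) (ℕ.*-monoʳ-≤ 3 (length-subsetsOfSize n u)))

subsetsOf : ∀ {n} → Subset n → List (Subset n)
subsetsOf []            = [] ∷ []
subsetsOf (inside ∷ U)  = map (inside ∷_) (subsetsOf U) ++ map (outside ∷_) (subsetsOf U)
subsetsOf (outside ∷ U) = map (outside ∷_) (subsetsOf U)

∈-subsetsOf : ∀ {n} {S U : Subset n} → S Subset.⊆ U → S ∈ subsetsOf U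
∈-subsetsOf {S = []}          {[]}          _   = here refl
∈-subsetsOf {S = inside ∷ S}  {inside ∷ U}  S⊆U = ∈-++⁺ˡ (∈-map⁺ (inside ∷_) (∈-subsetsOf (Subset.drop-∷-⊆ S⊆U)))
∈-subsetsOf {S = outside ∷ S} {inside ∷ U}  S⊆U =
  ∈-++⁺ʳ (map (inside ∷_) (subsetsOf U)) (∈-map⁺ (outside ∷_) (∈-subsetsOf (Subset.drop-∷-⊆ S⊆U)))
∈-subsetsOf {S = inside ∷ S}  {outside ∷ U} S⊆U = case S⊆U here of λ ()
∈-subsetsOf {S = outside ∷ S} {outside ∷ U} S⊆U = ∈-map⁺ (outside ∷_) (∈-subsetsOf (Subset.drop-∷-⊆ S⊆U))

length-subsetsOf : ∀ {n} (U : Subset n) → length (subsetsOf U) ≡ 2 ^ ∣ U ∣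
length-subsetsOf []            = refl
length-subsetsOf (inside ∷ U)  = trans (List.length-++ (map (inside ∷_) (subsetsOf U)))
  (cong₂ _+_ (trans (List.length-map _ (subsetsOf U)) (length-subsetsOf U))
             (trans (List.length-map _ (subsetsOf U)) (trans (length-subsetsOf U) (sym (ℕ.+-identityʳ _)))))
length-subsetsOf (outside ∷ U) = trans (List.length-map _ (subsetsOf U)) (length-subsetsOf U)

∣S∣≤count : ∀ {n} (S : Subset n) → ∣ S ∣ ≤ length (filter (_∈? S) (allFin n))
∣S∣≤count []      = z≤n
∣S∣≤count (s ∷ S) = extend s
  where
  shift : ∀ s {k} (f : Fin k → Fin _) →
    length (filter (_∈? (s ∷ S)) (tabulate (suc ∘ f))) ≡ length (filter (_∈? S) (tabulate f))
  shift s {zero}  f = refl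
  shift s {suc k} f with does (f zero ∈? S)
  ... | true  = cong suc (shift s (f ∘ suc))
  ... | false = shift s (f ∘ suc)
  extend : ∀ s → ∣ s ∷ S ∣ ≤ length (filter (_∈? (s ∷ S)) (allFin _))
  extend inside  = s≤s (subst (∣ S ∣ ≤_) (sym (shift inside id)) (∣S∣≤count S))
  extend outside = subst (∣ S ∣ ≤_) (sym (shift outside id)) (∣S∣≤count S)

eventsFor : ∀ {n} → ℕ → Subset n → List (Event n)
eventsFor d U = map (_, U) (filter (λ S → 2 * ∣ U ∣ ≤? d * ∣ S ∣) (subsetsOf U))

eventsOfSize : ∀ {n} → ℕ → ℕ → List (Event n)
eventsOfSize {n} d u = concatMap (eventsFor d) (subsetsOfSize n u)

-- Size 0 has to be left out: the pair of two empty sets can never be refuted, and its weight alone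
-- would reach the bound.
events : ∀ {n} → ℕ → ℕ → List (Event n)
events d zero    = []
events d (suc k) = eventsOfSize d (suc k) ++ events d k

∈-eventsOfSize⁺ : ∀ {n d} {S U : Subset n} → S Subset.⊆ U → 2 * ∣ U ∣ ≤ d * ∣ S ∣ →
  (S , U) ∈ eventsOfSize d ∣ U ∣
∈-eventsOfSize⁺ {d = d} {S} {U} S⊆U le = ∈-concatMap⁺ (eventsFor d) (lose (∈-subsetsOfSize⁺ U)
  (∈-map⁺ (_, U) (∈-filter⁺ (λ S → 2 * ∣ U ∣ ≤? d * ∣ S ∣) (∈-subsetsOf S⊆U) le)))

∈-eventsOfSize⁻ : ∀ {n} d u {S U : Subset n} → (S , U) ∈ eventsOfSize d u → ∣ U ∣ ≡ u × 2 * u ≤ d * ∣ S ∣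
∈-eventsOfSize⁻ {n} d u SU∈ with find (∈-concatMap⁻ (eventsFor d) {xs = subsetsOfSize n u} SU∈)
... | V , V∈ , SU∈V with ∈-map⁻ (_, V) SU∈V
...   | S , S∈ , refl = ∣V∣≡u , subst (λ u → 2 * u ≤ d * ∣ S ∣) ∣V∣≡u (proj₂ (∈-filter⁻ (λ S → 2 * ∣ V ∣ ≤? d * ∣ S ∣) {xs = subsetsOf V} S∈))
  where ∣V∣≡u = ∈-subsetsOfSize⁻ n u V∈

∈-events : ∀ {n d k} {S U : Subset n} → 1 ≤ ∣ U ∣ → ∣ U ∣ ≤ k → S Subset.⊆ U → 2 * ∣ U ∣ ≤ d * ∣ S ∣ →
  (S , U) ∈ events d k
∈-events {k = zero} 1≤U U≤0 = contradiction (ℕ.≤-trans 1≤U U≤0) λ ()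
∈-events {d = d} {k = suc k} {S} {U} 1≤U U≤1+k S⊆U le with ℕ.m≤n⇒m<n∨m≡n U≤1+k
... | inj₁ U<1+k = ∈-++⁺ʳ (eventsOfSize d (suc k)) (∈-events 1≤U (s≤s⁻¹ U<1+k) S⊆U le)
... | inj₂ U≡1+k = ∈-++⁺ˡ (subst (λ u → (S , U) ∈ eventsOfSize d u) U≡1+k (∈-eventsOfSize⁺ {d = d} S⊆U le))

length-eventsOfSize : ∀ {n} d u → length (eventsOfSize {n} d u) ≤ length (subsetsOfSize n u) * 2 ^ u
length-eventsOfSize {n} d u = bound (subsetsOfSize n u) (∈-subsetsOfSize⁻ n u)
  where
  bound : ∀ Us → (∀ {U} → U ∈ Us → ∣ U ∣ ≡ u) → length (concatMap (eventsFor d) Us) ≤ length Us * 2 ^ u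
  bound []       _    = z≤n
  bound (U ∷ Us) size = begin
    length (eventsFor d U ++ concatMap (eventsFor d) Us)         ≡⟨ List.length-++ (eventsFor d U) ⟩
    length (eventsFor d U) + length (concatMap (eventsFor d) Us) ≤⟨ ℕ.+-mono-≤ one (bound Us (size ∘ there)) ⟩
    2 ^ u + length Us * 2 ^ u                                    ∎
    where
    open ℕ.≤-Reasoning
    one : length (eventsFor d U) ≤ 2 ^ u
    one = begin
      length (eventsFor d U)       ≡⟨ List.length-map _ (filter (λ S → 2 * ∣ U ∣ ≤? d * ∣ S ∣) (subsetsOf U)) ⟩
      length (filter _ (subsetsOf U)) ≤⟨ List.length-filter _ (subsetsOf U) ⟩
      length (subsetsOf U)         ≡⟨ length-subsetsOf U ⟩
      2 ^ ∣ U ∣                    ≡⟨ cong (2 ^_) (size (here refl)) ⟩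
      2 ^ u                        ∎

-- Weights before the first expansion round

repeated : ∀ {n} → ℕ → List (Fin n) → List (Fin n)
repeated t = concatMap (replicate t)

module Initial {n : ℕ} (m d : ℕ) .{{_ : NonZero m}} where
  open Potential {n} m

  weight-replicate : ∀ t v vs e → weight (replicate t v ++ vs) e ≡ factor v e ^ t * weight vs e
  weight-replicate zero    v vs e = sym (ℕ.+-identityʳ _)
  weight-replicate (suc t) v vs e = trans (cong (factor v e *_) (weight-replicate t v vs e))
    (sym (ℕ.*-assoc (factor v e) (factor v e ^ t) _))

  -- The c entries that belong to S contribute 2∣U∣ each and all others m. Multiplying by m^c avoids
  -- a subtraction in the exponent.
  weight-repeated : ∀ t vs (S U : Subset n) → let c = t * length (filter (_∈? S) vs) in
    weight (repeated t vs) (S , U) * m ^ c ≡ (2 * ∣ U ∣) ^ c * m ^ length (repeated t vs)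
  weight-repeated t []       S U rewrite ℕ.*-zeroʳ t = refl
  weight-repeated t (v ∷ vs) S U
    rewrite weight-replicate t v (repeated t vs) (S , U)
          | List.length-++ (replicate t v) {repeated t vs}
          | List.length-replicate t {v}
          | ℕ.^-distribˡ-+-* m t (length (repeated t vs))
    with does (v ∈? S)
  ... | false = trans (ℕ.*-assoc (m ^ t) _ _)
                  (trans (cong (m ^ t *_) (weight-repeated t vs S U)) (swap (m ^ t) ((2 * ∣ U ∣) ^ (t * length (filter (_∈? S) vs))) _))
    where
    swap : ∀ a b c → a * (b * c) ≡ b * (a * c)
    swap = solve-∀
  ... | true
    rewrite ℕ.*-suc t (length (filter (_∈? S) vs))
          | ℕ.^-distribˡ-+-* m t (t * length (filter (_∈? S) vs))
          | ℕ.^-distribˡ-+-* (2 * ∣ U ∣) t (t * length (filter (_∈? S) vs))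
    = trans (rearrange ((2 * ∣ U ∣) ^ t) (weight (repeated t vs) (S , U)) (m ^ t) _)
        (trans (cong ((2 * ∣ U ∣) ^ t * m ^ t *_) (weight-repeated t vs S U))
          (rearrange′ ((2 * ∣ U ∣) ^ t) (m ^ t) _ _))
    where
    rearrange : ∀ a w x y → a * w * (x * y) ≡ a * x * (w * y)
    rearrange = solve-∀
    rearrange′ : ∀ a x b y → a * x * (b * y) ≡ a * b * (x * y)
    rearrange′ = solve-∀

  todo : List (Fin n)
  todo = repeated (4 * d) (allFin n)

  -- From 2u ≤ d∣S∣ the set S is owed at least 4d∣S∣ ≥ 8u edges. Every further edge only contributes
  -- a ratio 2u/m ≤ 1, which is estimated by 1.
  weight-bound : ∀ u {e} → 2 * u ≤ m → e ∈ eventsOfSize d u →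
    m ^ (8 * u) * weight todo e ≤ (2 * u) ^ (8 * u) * m ^ length todo
  weight-bound u {S , U} 2u≤m e∈ with ∈-eventsOfSize⁻ d u e∈
  ... | refl , 2u≤dS with ℕ.m≤n⇒∃[o]m+o≡n 8u≤c
    where
    open ℕ.≤-Reasoning
    c = 4 * d * length (filter (_∈? S) (allFin n))
    8u≤c : 8 * ∣ U ∣ ≤ c
    8u≤c = begin
      8 * ∣ U ∣          ≡⟨ ℕ.*-assoc 4 2 ∣ U ∣ ⟩
      4 * (2 * ∣ U ∣)    ≤⟨ ℕ.*-monoʳ-≤ 4 2u≤dS ⟩
      4 * (d * ∣ S ∣)    ≡⟨ ℕ.*-assoc 4 d ∣ S ∣ ⟨
      4 * d * ∣ S ∣      ≤⟨ ℕ.*-monoʳ-≤ (4 * d) (∣S∣≤count S) ⟩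
      c                  ∎
  ... | r , 8u+r≡c = ℕ.*-cancelʳ-≤ _ _ (m ^ r) {{ℕ.m^n≢0 m r}} (begin
      m ^ P * w * m ^ r                  ≡⟨ rearrange (m ^ P) w (m ^ r) ⟩
      w * (m ^ P * m ^ r)                ≡⟨ cong (w *_) (ℕ.^-distribˡ-+-* m P r) ⟨
      w * m ^ (P + r)                    ≡⟨ subst (λ c → w * m ^ c ≡ v ^ c * M) (sym 8u+r≡c) (weight-repeated (4 * d) (allFin n) S U) ⟩
      v ^ (P + r) * M                    ≡⟨ cong (_* M) (ℕ.^-distribˡ-+-* v P r) ⟩
      v ^ P * v ^ r * M                  ≤⟨ ℕ.*-monoˡ-≤ M (ℕ.*-monoʳ-≤ (v ^ P) (ℕ.^-monoˡ-≤ r 2u≤m)) ⟩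
      v ^ P * m ^ r * M                  ≡⟨ rearrange′ (v ^ P) (m ^ r) M ⟩
      v ^ P * M * m ^ r                  ∎)
    where
    open ℕ.≤-Reasoning
    P = 8 * ∣ U ∣
    v = 2 * ∣ U ∣
    w = weight todo (S , U)
    M = m ^ length todo
    rearrange : ∀ a w b → a * w * b ≡ w * (a * b)
    rearrange = solve-∀
    rearrange′ : ∀ a b M → a * b * M ≡ a * M * b
    rearrange′ = solve-∀

  -- Union bound: at most (3n/u)^u 2^u pairs, each of relative weight at most (2u/m)^(8u). Another
  -- 2^u is demanded so that the sum over all sizes becomes geometric; the 12 in the hypothesis is 3
  -- · 2 · 2.
  Φ-ofSize : ∀ u → 1 ≤ u → 2 * u ≤ m → 12 * n * (2 * u) ^ 8 ≤ u * m ^ 8 →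
    2 ^ u * Φ todo (eventsOfSize d u) ≤ m ^ length todo
  Φ-ofSize u 1≤u 2u≤m small = ℕ.*-cancelʳ-≤ _ _ ((u * m ^ 8) ^ u) (begin
    2 ^ u * φ * (u * m ^ 8) ^ u            ≡⟨ cong (2 ^ u * φ *_) (trans (^-distribʳ-* u u (m ^ 8)) (cong (u ^ u *_) (ℕ.^-*-assoc m 8 u))) ⟩
    2 ^ u * φ * (u ^ u * m ^ (8 * u))      ≡⟨ rearrange (2 ^ u) φ (u ^ u) (m ^ (8 * u)) ⟩
    2 ^ u * u ^ u * (m ^ (8 * u) * φ)      ≤⟨ ℕ.*-monoʳ-≤ (2 ^ u * u ^ u) φ-bound ⟩
    2 ^ u * u ^ u * (c * 2 ^ u * (v * M))  ≡⟨ rearrange₂ (2 ^ u) (u ^ u) c v M ⟩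
    c * u ^ u * (2 ^ u * 2 ^ u) * v * M    ≤⟨ ℕ.*-monoˡ-≤ M (ℕ.*-monoˡ-≤ v (ℕ.*-monoˡ-≤ (2 ^ u * 2 ^ u) (length-subsetsOfSize n u))) ⟩
    (3 * n) ^ u * (2 ^ u * 2 ^ u) * v * M  ≡⟨ cong (_* M) powers ⟩
    (12 * n * (2 * u) ^ 8) ^ u * M         ≤⟨ ℕ.*-monoˡ-≤ M (ℕ.^-monoˡ-≤ u small) ⟩
    (u * m ^ 8) ^ u * M                    ≡⟨ ℕ.*-comm _ M ⟩
    M * (u * m ^ 8) ^ u                    ∎)
    where
    open ℕ.≤-Reasoning
    instance
      _ : NonZero u
      _ = >-nonZero 1≤u
      _ : NonZero (m ^ 8)
      _ = ℕ.m^n≢0 m 8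
      _ : NonZero (u * m ^ 8)
      _ = ℕ.m*n≢0 u (m ^ 8)
      _ : NonZero ((u * m ^ 8) ^ u)
      _ = ℕ.m^n≢0 (u * m ^ 8) u
    φ = Φ todo (eventsOfSize d u)
    M = m ^ length todo
    c = length (subsetsOfSize n u)
    v = (2 * u) ^ (8 * u)
    rearrange : ∀ a p b x → a * p * (b * x) ≡ a * b * (x * p)
    rearrange = solve-∀
    rearrange₂ : ∀ a b c v M → a * b * (c * a * (v * M)) ≡ c * b * (a * a) * v * M
    rearrange₂ = solve-∀
    φ-bound : m ^ (8 * u) * φ ≤ c * 2 ^ u * (v * M)
    φ-bound = begin
      m ^ (8 * u) * φ                                             ≡⟨ ∑-* (eventsOfSize d u) (m ^ (8 * u)) (weight todo) ⟨
      ∑ (eventsOfSize d u) (λ e → m ^ (8 * u) * weight todo e)    ≤⟨ ∑-bound (eventsOfSize d u) _ (weight-bound u 2u≤m) ⟩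
      length (eventsOfSize {n} d u) * (v * M)                      ≤⟨ ℕ.*-monoˡ-≤ (v * M) (length-eventsOfSize {n} d u) ⟩
      c * 2 ^ u * (v * M)                                         ∎
    regroup : ∀ n → 12 * n ≡ 3 * n * 4
    regroup = solve-∀
    powers : (3 * n) ^ u * (2 ^ u * 2 ^ u) * v ≡ (12 * n * (2 * u) ^ 8) ^ u
    powers = begin-equality
      (3 * n) ^ u * (2 ^ u * 2 ^ u) * v        ≡⟨ cong (λ x → (3 * n) ^ u * x * v) (^-distribʳ-* u 2 2) ⟨
      (3 * n) ^ u * 4 ^ u * v                  ≡⟨ cong₂ _*_ (^-distribʳ-* u (3 * n) 4) (ℕ.^-*-assoc (2 * u) 8 u) ⟨
      (3 * n * 4) ^ u * ((2 * u) ^ 8) ^ u      ≡⟨ ^-distribʳ-* u (3 * n * 4) ((2 * u) ^ 8) ⟨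
      (3 * n * 4 * (2 * u) ^ 8) ^ u            ≡⟨ cong (λ x → (x * (2 * u) ^ 8) ^ u) (regroup n) ⟨
      (12 * n * (2 * u) ^ 8) ^ u               ∎

  initial-Φ : ∀ k → (∀ {u} → 1 ≤ u → u ≤ k → 2 * u ≤ m × 12 * n * (2 * u) ^ 8 ≤ u * m ^ 8) →
    Φ todo (events d k) < m ^ length todo
  initial-Φ k small = ℕ.*-cancelˡ-< (2 ^ k) _ _ (ℕ.≤-trans (ℕ.m<m+n _ (ℕ.m^n>0 m (length todo))) (geometric k ℕ.≤-refl))
    where
    open ℕ.≤-Reasoning
    M = m ^ length todo
    -- Relative to M, the sizes up to j weigh at most 1 - 2^(-j). The summand M is the missing
    -- 2^(-j) and makes the final inequality strict.
    geometric : ∀ j → j ≤ k → 2 ^ j * Φ todo (events d j) + M ≤ 2 ^ j * M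
    geometric zero    _   = ℕ.≤-reflexive (sym (ℕ.+-identityʳ M))
    geometric (suc j) j<k = begin
      2 * 2 ^ j * Φ todo (events d (suc j)) + M
        ≡⟨ cong (λ x → 2 * 2 ^ j * x + M) (∑-++ (eventsOfSize d (suc j)) (events d j) (weight todo)) ⟩
      2 * 2 ^ j * (a + b) + M               ≡⟨ expand (2 ^ j) a b M ⟩
      2 * 2 ^ j * a + (2 * (2 ^ j * b) + M) ≤⟨ ℕ.+-monoˡ-≤ _ (let 2u≤m , s = small (s≤s z≤n) j<k in Φ-ofSize (suc j) (s≤s z≤n) 2u≤m s) ⟩
      M + (2 * (2 ^ j * b) + M)             ≡⟨ collect (2 ^ j * b) M ⟩
      2 * (2 ^ j * b + M)                   ≤⟨ ℕ.*-monoʳ-≤ 2 (geometric j (ℕ.<⇒≤ j<k)) ⟩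
      2 * (2 ^ j * M)                       ≡⟨ ℕ.*-assoc 2 (2 ^ j) M ⟨
      2 * 2 ^ j * M                         ∎
      where
      a = Φ todo (eventsOfSize d (suc j))
      b = Φ todo (events d j)
      expand : ∀ x a b M → 2 * x * (a + b) + M ≡ 2 * x * a + (2 * (x * b) + M)
      expand = solve-∀
      collect : ∀ x M → M + (2 * x + M) ≡ 2 * (x + M)
      collect = solve-∀

-- Forcing the expansion events

-- By `one-way` an edge is in the care of one endpoint only, so that offers at other vertices do not
-- shrink a pool. The surplus of t * (q + 1) in `pool-size` pays for the t rounds of the vertex
-- itself, so at least m edges are available in each of them.
module Expansion {n q : ℕ} (m t : ℕ) (2[1+q]≤m : 2 * suc q ≤ m) (pool : Fin n → List (Fin n))
  (pool-unique : ∀ v → Unique (pool v)) (pool-size : ∀ v → m + t * suc q ≤ length (pool v))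
  (one-way : ∀ {u v} → u ∈ pool v → v ∉ pool u) (E₀ : List (Event n)) where

  open Potential {n} m

  Witnessed : Position n → Event n → Set
  Witnessed p (S , U) = ∃[ v ] ∃[ x ] (v Subset.∈ S × x Subset.∉ U × AdjC p v x)

  Linked : Position n → Fin n → Set
  Linked p v = ∃[ x ] (x ∈ pool v × AdjC p v x)

  record State (todo ahead : List (Fin n)) (E : List (Event n)) (p : Position n) : Set where
    field
      potential : Φ todo E < m ^ length todo
      account   : ∀ {e} → e ∈ E₀ → e ∈ E ⊎ Witnessed p e
      fresh     : ∀ {v x} → v ∈ ahead → x ∈ pool v → Fresh p v x

  record Available (v : Fin n) (j : ℕ) (xs : List (Fin n)) (p : Position n) : Set where
    field
      unique : Unique xs
      ⊆pool  : xs ⊆ pool v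
      size   : m + j * suc q ≤ length xs
      fresh  : ∀ {x} → x ∈ xs → Fresh p v x

  self∉pool : ∀ {v} → v ∉ pool v
  self∉pool v∈ = one-way v∈ v∈

  serveOnce : ∀ {v j rest ahead E xs p} → v ∉ ahead → Available v (suc j) xs p → State (v ∷ rest) ahead E p →
    Forces {q = q} (λ p′ → p ⊑ p′ × Linked p′ v × (∃[ xs′ ] Available v j xs′ p′) × (∃[ E′ ] State rest ahead E′ p′)) 1 p
  serveOnce {v} {j} {rest} {ahead} {E} {xs} {p} v∉ahead avail state =
    offerSelected (select-good v rest (suc q) A.unique 2[1+q]≤m (ℕ.≤-trans (ℕ.m≤m+n m _) A.size) E)
    where
    module A = Available avail
    module S = State state
    module _ (sel : Selection (Good v rest E) (suc q) xs) where
      open Selection sel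
      next : ∀ {p′} → Star⟨ p ⟩ v pick p′ →
        p ⊑ p′ × Linked p′ v × (∃[ xs′ ] Available v j xs′ p′) × (∃[ E′ ] State rest ahead E′ p′)
      next {p′} out = (λ {u} {w} → mono {u} {w}) , (x , A.⊆pool (pick-∈ chosen) , adj)
        , (others , record
          { unique = others-uniq
          ; ⊆pool  = A.⊆pool ∘ others-⊆
          ; size   = ℕ.+-cancelˡ-≤ (suc q) _ _ (subst (suc q + (m + j * suc q) ≤_) (sym size)
                       (ℕ.≤-trans (ℕ.≤-reflexive (shuffle (suc q) m (j * suc q))) A.size))
          ; fresh  = λ y∈ → fresh (A.fresh (others-⊆ y∈))
              λ { i (inj₁ (_ , eq)) → separate i y∈ eq
                ; i (inj₂ (refl , _)) → self∉pool (A.⊆pool (others-⊆ y∈)) } })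
        , (survivors v x E , record
          { potential = good-descends v rest E (pick-P chosen) S.potential
          ; account   = account′
          -- An offered edge could be reserved for `w` only if `w` is `v`, or if `w` and `v` lie in
          -- each other's pools.
          ; fresh     = λ {w} {y} w∈ y∈ → fresh (S.fresh w∈ y∈)
              λ { i (inj₁ (refl , _)) → v∉ahead w∈
                ; i (inj₂ (refl , eq)) → one-way (A.⊆pool (pick-∈ i)) (subst (λ w → v ∈ pool w) (sym eq) y∈) } })
        where
        open Offered out
        x = pick chosen
        shuffle : ∀ a b c → a + (b + c) ≡ b + (a + c)
        shuffle a b c = trans (sym (ℕ.+-assoc a b c)) (trans (cong (_+ c) (ℕ.+-comm a b)) (ℕ.+-assoc b a c))
        account′ : ∀ {e} → e ∈ E₀ → e ∈ survivors v x E ⊎ Witnessed p′ e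
        account′ {S , U} e∈ with S.account e∈
        ... | inj₂ (u , y , u∈ , y∉ , uy) = inj₂ (u , y , u∈ , y∉ , mono {u} {y} uy)
        ... | inj₁ e∈E with compatible? v x (S , U)
        ...   | yes comp = inj₁ (∈-filter⁺ (compatible? v x) e∈E comp)
        ...   | no ¬comp with v ∈? S
        ...     | yes v∈S = inj₂ (v , x , v∈S , ¬comp ∘ inj₂ , adj)
        ...     | no  v∉S = contradiction (inj₁ v∉S) ¬comp
      offerSelected : Forces {q = q} (λ p′ → p ⊑ p′ × Linked p′ v × (∃[ xs′ ] Available v j xs′ p′) × (∃[ E′ ] State rest ahead E′ p′)) 1 p
      offerSelected = offer-star v pick pick-inj ℕ.≤-refl
        (λ i v≡ → self∉pool (subst (_∈ pool v) (sym v≡) (A.⊆pool (pick-∈ i))))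
        (λ i → A.fresh (pick-∈ i))
        >>= λ out → done (next out)

  serveVertex : ∀ j {v rest ahead E xs p} → v ∉ ahead → Available v j xs p →
    State (replicate j v ++ rest) ahead E p →
    Forces {q = q} (λ p′ → p ⊑ p′ × (1 ≤ j → Linked p′ v) × (∃[ E′ ] State rest ahead E′ p′)) j p
  serveVertex zero    _       _     state = done (id , (λ ()) , _ , state)
  serveVertex (suc j) {v} v∉ahead avail state =
    serveOnce v∉ahead avail state >>= λ (p⊑p′ , (x , x∈ , vx) , (_ , avail′) , (_ , state′)) →
    mapForces (λ {p″} (p′⊑p″ , _ , state″) →
        (λ {u} {w} → p′⊑p″ {u} {w} ∘ p⊑p′ {u} {w}) , (λ _ → x , x∈ , p′⊑p″ {v} {x} vx) , state″)
      (serveVertex j v∉ahead avail′ state′)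

  serveAll : ∀ {vs E p} → 1 ≤ t → Unique vs → State (repeated t vs) vs E p →
    Forces {q = q} (λ p′ → p ⊑ p′ × (∀ {v} → v ∈ vs → Linked p′ v) × (∃[ E′ ] State [] [] E′ p′)) (length vs * t) p
  serveAll {[]}     _   _ state = done (id , (λ ()) , _ , state)
  serveAll {v ∷ vs} {p = p} 1≤t (v∉ AllPairs.∷ uniq) state =
    serveVertex t (λ v∈ → All.lookup v∉ v∈ refl)
      (record { unique = pool-unique v ; ⊆pool = id ; size = pool-size v ; fresh = fresh (here refl) })
      (record { potential = potential ; account = account ; fresh = λ w∈ → fresh (there w∈) })
    >>= λ (p⊑p′ , link , _ , state′) →
    mapForces (λ {p″} (p′⊑p″ , links , state″) →
        (λ {u} {w} → p′⊑p″ {u} {w} ∘ p⊑p′ {u} {w})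
        , (λ { (here refl) → let x , x∈ , vx = link 1≤t in x , x∈ , p′⊑p″ {v} {x} vx
             ; (there v∈) → links v∈ })
        , state″)
      (serveAll 1≤t uniq state′)
    where open State state

  -- Once no edge is owed, each surviving event has weight 1 while the bound is m^0 = 1, so none
  -- survives.
  all-witnessed : ∀ {E p} → State [] [] E p → ∀ {e} → e ∈ E₀ → Witnessed p e
  all-witnessed {[]}    state e∈ with State.account state e∈
  ... | inj₂ w = w
  all-witnessed {_ ∷ _} state e∈ = contradiction (State.potential state) λ { (s≤s ()) }

  serve : ∀ {vs p} → 1 ≤ t → Unique vs → Φ (repeated t vs) E₀ < m ^ length (repeated t vs) →
    (∀ {v x} → v ∈ vs → x ∈ pool v → Fresh p v x) →
    Forces {q = q} (λ p′ → p ⊑ p′ × (∀ {v} → v ∈ vs → Linked p′ v) × (∀ {e} → e ∈ E₀ → Witnessed p′ e))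
      (length vs * t) p
  serve 1≤t uniq Φ< fresh = mapForces (λ (p⊑p′ , links , _ , state) → p⊑p′ , links , all-witnessed state)
    (serveAll 1≤t uniq record { potential = Φ< ; account = inj₁ ; fresh = fresh })

-- Rational hypotheses and conclusions as inequalities in ℕ

fromℕ≤/⇒ : ∀ a b c .{{_ : NonZero c}} → fromℕ a ℚ.≤ + b / c → a * c ≤ b
fromℕ≤/⇒ a b c@(suc c-1) le = ℤ.drop‿+≤+ (subst₂ ℤ._≤_ (sym (ℤ.pos-* a c)) (ℤ.*-identityʳ (+ b))
  (ℚᵘ.drop-*≤* (ℚᵘ.≤-respˡ-≃ (ℚ.toℚᵘ-fromℚᵘ (mkℚᵘ (+ a) 0))
    (ℚᵘ.≤-respʳ-≃ (ℚ.toℚᵘ-fromℚᵘ (mkℚᵘ (+ b) c-1)) (ℚ.toℚᵘ-mono-≤ le)))))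

fromℕ≤1/*⇒ : ∀ a b c .{{_ : NonZero c}} → fromℕ a ℚ.≤ (+ 1 / c) ℚ.* fromℕ b → a * c ≤ b
fromℕ≤1/*⇒ a b c@(suc c-1) le = ℤ.drop‿+≤+ (subst₂ ℤ._≤_
  (trans (cong (λ x → + a ℤ.* + x) (ℕ.*-identityʳ c)) (sym (ℤ.pos-* a c)))
  (trans (ℤ.*-identityʳ _) (ℤ.*-identityˡ (+ b)))
  (ℚᵘ.drop-*≤* (ℚᵘ.≤-respˡ-≃ (ℚ.toℚᵘ-fromℚᵘ (mkℚᵘ (+ a) 0)) (ℚᵘ.≤-respʳ-≃ rhs (ℚ.toℚᵘ-mono-≤ le)))))
  where
  rhs : ℚ.toℚᵘ ((+ 1 / c) ℚ.* fromℕ b) ℚᵘ.≃ mkℚᵘ (+ 1) c-1 ℚᵘ.* mkℚᵘ (+ b) 0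
  rhs = ℚᵘ.≃-trans (ℚ.toℚᵘ-homo-* (+ 1 / c) (fromℕ b))
    (ℚᵘ.*-cong (ℚ.toℚᵘ-fromℚᵘ (mkℚᵘ (+ 1) c-1)) (ℚ.toℚᵘ-fromℚᵘ (mkℚᵘ (+ b) 0)))

[d/2-1]*≤⇐ : ∀ d s b → d * s ≤ 2 * b + 2 * s → ((+ d / 2) ℚ.- 1ℚ) ℚ.* fromℕ s ℚ.≤ fromℕ b
[d/2-1]*≤⇐ d s b le = ℚ.toℚᵘ-cancel-≤
  (ℚᵘ.≤-respˡ-≃ (ℚᵘ.≃-sym lhs) (ℚᵘ.≤-respʳ-≃ (ℚᵘ.≃-sym (ℚ.toℚᵘ-fromℚᵘ (mkℚᵘ (+ b) 0)))
    (*≤* (subst₂ ℤ._≤_ (lhs-ring (+ d) (+ s)) (ℤ.*-comm (+ 2) (+ b)) bound))))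
  where
  open ℤ.≤-Reasoning
  lhs : ℚ.toℚᵘ (((+ d / 2) ℚ.- 1ℚ) ℚ.* fromℕ s) ℚᵘ.≃ (mkℚᵘ (+ d) 1 ℚᵘ.+ mkℚᵘ -[1+ 0 ] 0) ℚᵘ.* mkℚᵘ (+ s) 0
  lhs = ℚᵘ.≃-trans (ℚ.toℚᵘ-homo-* ((+ d / 2) ℚ.- 1ℚ) (fromℕ s))
    (ℚᵘ.*-cong (ℚᵘ.≃-trans (ℚ.toℚᵘ-homo-+ (+ d / 2) (ℚ.- 1ℚ))
                 (ℚᵘ.+-cong (ℚ.toℚᵘ-fromℚᵘ (mkℚᵘ (+ d) 1)) ℚᵘ.≃-refl))
               (ℚ.toℚᵘ-fromℚᵘ (mkℚᵘ (+ s) 0)))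
  lhs-ring : ∀ d s → d ℤ.* s ℤ.+ ℤ.- (+ 2 ℤ.* s) ≡ (d ℤ.* + 1 ℤ.+ -[1+ 1 ]) ℤ.* s ℤ.* + 1
  lhs-ring = ℤ.solve-∀
  cancel : ∀ x y → x ℤ.+ y ℤ.+ ℤ.- y ≡ x
  cancel = ℤ.solve-∀
  bound : + d ℤ.* + s ℤ.+ ℤ.- (+ 2 ℤ.* + s) ℤ.≤ + 2 ℤ.* + b
  bound = begin
    + d ℤ.* + s ℤ.+ ℤ.- (+ 2 ℤ.* + s)                    ≡⟨ cong (ℤ._+ _) (ℤ.pos-* d s) ⟨
    + (d * s) ℤ.+ ℤ.- (+ 2 ℤ.* + s)                      ≤⟨ ℤ.+-monoˡ-≤ (ℤ.- (+ 2 ℤ.* + s)) (ℤ.+≤+ le) ⟩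
    + (2 * b + 2 * s) ℤ.+ ℤ.- (+ 2 ℤ.* + s)              ≡⟨ cong (ℤ._+ _) (cong₂ ℤ._+_ (ℤ.pos-* 2 b) (ℤ.pos-* 2 s)) ⟩
    + 2 ℤ.* + b ℤ.+ + 2 ℤ.* + s ℤ.+ ℤ.- (+ 2 ℤ.* + s)    ≡⟨ cancel (+ 2 ℤ.* + b) (+ 2 ℤ.* + s) ⟩
    + 2 ℤ.* + b                                          ∎

-- As the ceiling of p is the negated floor of -p, the division estimate is applied to -p and the
-- result negated.
≤ceiling⇒ : ∀ p k → + suc k ℤ.≤ ceiling p → + k ℤ.* ↧ p ℤ.< ↥ p
≤ceiling⇒ p@record{} k le = ℤ.neg-cancel-< (begin-strict
  ℤ.- ↥ p                                              ≡⟨ ℚ.↥-neg p ⟨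
  ↥ r                                                  <⟨ ℤ.n<s[n/ℕd]*d (↥ r) (↧ₙ r) ⟩
  ℤ.suc (↥ r ℤ./ℕ ↧ₙ r) ℤ.* ↧ r                        ≡⟨ cong (λ x → ℤ.suc x ℤ.* ↧ r) (ℤ.div-pos-is-/ℕ (↥ r) (↧ₙ r)) ⟨
  ℤ.suc (↥ r ℤ./ ↧ r) ℤ.* ↧ r                          ≡⟨ cong (λ x → ℤ.suc x ℤ.* ↧ r) (floor≡ r) ⟨
  ℤ.suc (floor r) ℤ.* ↧ r                              ≤⟨ ℤ.*-monoʳ-≤-nonNeg (↧ r) (ℤ.suc-mono floor≤) ⟩
  ℤ.suc (ℤ.- + suc k) ℤ.* ↧ r                          ≡⟨ cong₂ ℤ._*_ (suc-neg k) (ℚ.↧-neg p) ⟩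
  ℤ.- + k ℤ.* ↧ p                                      ≡⟨ ℤ.neg-distribˡ-* (+ k) (↧ p) ⟨
  ℤ.- (+ k ℤ.* ↧ p)                                    ∎)
  where
  open ℤ.≤-Reasoning
  r = ℚ.- p
  floor≡ : ∀ p → floor p ≡ ↥ p ℤ./ ↧ p
  floor≡ record{} = refl
  suc-neg : ∀ k → ℤ.suc (ℤ.- + suc k) ≡ ℤ.- + k
  suc-neg zero    = refl
  suc-neg (suc k) = refl
  floor≤ : floor r ℤ.≤ ℤ.- + suc k
  floor≤ = subst (ℤ._≤ ℤ.- + suc k) (ℤ.neg-involutive (floor r)) (ℤ.neg-mono-≤ le)

≤ceiling/⇒ : ∀ n c k .{{_ : NonZero c}} → + suc k ℤ.≤ ceiling (+ n / c) → k * c < n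
≤ceiling/⇒ n c@(suc c-1) k le with ℚ.toℚᵘ-fromℚᵘ (mkℚᵘ (+ n) c-1)
... | *≡* eq = ℤ.drop‿+<+ (subst (ℤ._< + n) (sym (ℤ.pos-* k c)) (ℤ.*-cancelʳ-<-nonNeg (↧ p) (begin-strict
  + k ℤ.* + c ℤ.* ↧ p    ≡⟨ swap (+ k) (+ c) (↧ p) ⟩
  + k ℤ.* ↧ p ℤ.* + c    <⟨ ℤ.*-monoʳ-<-pos (+ c) (≤ceiling⇒ p k le) ⟩
  ↥ p ℤ.* + c            ≡⟨ cong₂ ℤ._*_ (sym (ℚ.↥ᵘ-toℚᵘ p)) refl ⟩
  ℚᵘ.↥ (ℚ.toℚᵘ p) ℤ.* + c ≡⟨ eq ⟩
  + n ℤ.* ℚᵘ.↧ (ℚ.toℚᵘ p) ≡⟨ cong (+ n ℤ.*_) (ℚ.↧ᵘ-toℚᵘ p) ⟩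
  + n ℤ.* ↧ p            ∎)))
  where
  open ℤ.≤-Reasoning
  p = + n / c
  swap : ∀ a b c → a ℤ.* b ℤ.* c ≡ a ℤ.* c ℤ.* b
  swap = ℤ.solve-∀

-- Expansion from witnessed events

∣p∪q∣≤∣p∣+∣q∣ : ∀ {n} (p q : Subset n) → ∣ p ∪ q ∣ ≤ ∣ p ∣ + ∣ q ∣
∣p∪q∣≤∣p∣+∣q∣ []            []            = z≤n
∣p∪q∣≤∣p∣+∣q∣ (inside ∷ p)  (inside ∷ q)  = s≤s (ℕ.≤-trans (∣p∪q∣≤∣p∣+∣q∣ p q) (ℕ.+-monoʳ-≤ ∣ p ∣ (ℕ.n≤1+n ∣ q ∣)))
∣p∪q∣≤∣p∣+∣q∣ (inside ∷ p)  (outside ∷ q) = s≤s (∣p∪q∣≤∣p∣+∣q∣ p q)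
∣p∪q∣≤∣p∣+∣q∣ (outside ∷ p) (inside ∷ q)  = ℕ.≤-trans (s≤s (∣p∪q∣≤∣p∣+∣q∣ p q)) (ℕ.≤-reflexive (sym (ℕ.+-suc ∣ p ∣ ∣ q ∣)))
∣p∪q∣≤∣p∣+∣q∣ (outside ∷ p) (outside ∷ q) = ∣p∪q∣≤∣p∣+∣q∣ p q

∈-N : ∀ {n} (G : Graph n) {S u v} → v Subset.∉ S → u Subset.∈ S → Adj G u v → v Subset.∈ N G S
∈-N G {S} {u} {v} v∉S u∈S uv = Vec.lookup⇒[]= v (N G S) (trans (Vec.lookup∘tabulate _ v)
  (dec-true (¬? (v ∈? S) ×-dec Fin.any? (λ u → (u ∈? S) ×-dec adj? G u v)) (v∉S , u , u∈S , uv)))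

-- A set S that fails to expand would make U = S ∪ N(S) satisfy 2∣U∣ < d∣S∣ ≤ n/20, so the pair is
-- among the events. Its witness is an edge from S to a vertex outside U, but the end of such an
-- edge belongs to N(S).
expander : ∀ {n} d k (p : Position n) .{{_ : NonZero (20 * d)}} → n < 40 * suc k →
  (∀ {S U} → (S , U) ∈ events d k → ∃[ v ] ∃[ x ] (v Subset.∈ S × x Subset.∉ U × AdjC p v x)) →
  IsExpander ((+ d / 2) ℚ.- 1ℚ) (+ 1 / (20 * d)) (clientGraph p)
expander {n} d k p n<40[1+k] witness S small = [d/2-1]*≤⇐ d ∣ S ∣ ∣ M ∣ (ℕ.≮⇒≥ λ few →
  let 2U<dS : 2 * ∣ U ∣ < d * ∣ S ∣
      2U<dS = ℕ.≤-<-trans (ℕ.*-monoʳ-≤ 2 (∣p∪q∣≤∣p∣+∣q∣ S M)) (subst (_< d * ∣ S ∣) (rearrange ∣ M ∣ ∣ S ∣) few)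
      v , x , v∈S , x∉U , vx = witness (∈-events {d = d} {S = S} {U = U} (1≤∣U∣ few) (∣U∣≤k 2U<dS) (Subset.p⊆p∪q {p = S} M) (ℕ.<⇒≤ 2U<dS))
  in x∉U (Subset.x∈p∪q⁺ {p = S} (inj₂ (∈-N (clientGraph p) (x∉U ∘ Subset.p⊆p∪q {p = S} M) v∈S vx))))
  where
  open ℕ.≤-Reasoning
  M = N (clientGraph p) S
  U = S ∪ M
  rearrange : ∀ m s → 2 * m + 2 * s ≡ 2 * (s + m)
  rearrange = solve-∀
  1≤∣U∣ : 2 * ∣ M ∣ + 2 * ∣ S ∣ < d * ∣ S ∣ → 1 ≤ ∣ U ∣
  1≤∣U∣ few with ∣ S ∣ | Subset.∣p∣≤∣p∪q∣ S M
  ... | suc _ | S≤U = ℕ.≤-trans (s≤s z≤n) S≤U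
  ... | zero  | _   = contradiction (ℕ.≤-trans few (ℕ.≤-reflexive (ℕ.*-zeroʳ d))) λ ()
  ∣U∣≤k : 2 * ∣ U ∣ < d * ∣ S ∣ → ∣ U ∣ ≤ k
  ∣U∣≤k 2U<dS = s≤s⁻¹ (ℕ.*-cancelˡ-< 40 ∣ U ∣ (suc k) (begin-strict
    40 * ∣ U ∣         ≡⟨ ℕ.*-assoc 20 2 ∣ U ∣ ⟩
    20 * (2 * ∣ U ∣)   ≤⟨ ℕ.*-monoʳ-≤ 20 (ℕ.<⇒≤ 2U<dS) ⟩
    20 * (d * ∣ S ∣)   ≡⟨ regroup d ∣ S ∣ ⟩
    ∣ S ∣ * (20 * d)   ≤⟨ fromℕ≤1/*⇒ ∣ S ∣ n (20 * d) small ⟩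
    n                  <⟨ n<40[1+k] ⟩
    40 * suc k         ∎))
    where
    regroup : ∀ d s → 20 * (d * s) ≡ s * (20 * d)
    regroup = solve-∀

-- Assembling the strategy

block : ∀ {n} o k → o + k ≤ n → Fin k → Fin n
block o k le i = fromℕ< (ℕ.<-≤-trans (ℕ.+-monoʳ-< o (Fin.toℕ<n i)) le)

toℕ-block : ∀ {n} o k (le : o + k ≤ n) i → toℕ (block o k le i) ≡ o + toℕ i
toℕ-block o k le i = Fin.toℕ-fromℕ< _

block-injective : ∀ {n} o k (le : o + k ≤ n) → Injective _≡_ _≡_ (block o k le)
block-injective o k le {i} {j} eq = Fin.toℕ-injective (ℕ.+-cancelˡ-≡ o _ _
  (trans (sym (toℕ-block o k le i)) (trans (cong toℕ eq) (toℕ-block o k le j))))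

-- A cyclic order needs at least three elements for `next` applied twice to have no fixed point, and
-- this is what makes the pools one-way.
data Class : Set where
  inA inB inC : Class

next : Class → Class
next inA = inB
next inB = inC
next inC = inA

next²≢id : ∀ k → k ≢ next (next k)
next²≢id inA ()
next²≢id inB ()
next²≢id inC ()

-- Class A is the first block, which holds the path, together with the tail, which holds the leaves.
class : ℕ → ℕ → Class
class h x with x <? h | x <? h + h | x <? h + h + h
... | yes _ | _     | _     = inA
... | no _  | yes _ | _     = inB
... | no _  | no _  | yes _ = inC
... | no _  | no _  | no _  = inA

class-first : ∀ h {x} → x < h → class h x ≡ inA
class-first h {x} x<h with x <? h
... | yes _  = refl
... | no x≮h = contradiction x<h x≮h

class-second : ∀ h i → i < h → class h (h + i) ≡ inB
class-second h i i<h with h + i <? h | h + i <? h + h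
... | yes lt | _      = contradiction lt (ℕ.m+n≮m h i)
... | no _   | yes _  = refl
... | no _   | no nlt = contradiction (ℕ.+-monoʳ-< h i<h) nlt

class-third : ∀ h i → i < h → class h (h + h + i) ≡ inC
class-third h i i<h with h + h + i <? h | h + h + i <? h + h | h + h + i <? h + h + h
... | yes lt | _      | _      = contradiction (ℕ.≤-<-trans (ℕ.≤-trans (ℕ.m≤m+n h h) (ℕ.m≤m+n (h + h) i)) lt) (ℕ.<-irrefl refl)
... | no _   | yes lt | _      = contradiction lt (ℕ.m+n≮m (h + h) i)
... | no _   | no _   | yes _  = refl
... | no _   | no _   | no nlt = contradiction (ℕ.+-monoʳ-< (h + h) i<h) nlt

class-last : ∀ h {x} → h + h + h ≤ x → class h x ≡ inA
class-last h {x} le with x <? h | x <? h + h | x <? h + h + h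
... | yes _ | _      | _      = refl
... | no _  | yes lt | _      = contradiction (ℕ.≤-trans (ℕ.m≤m+n (h + h) h) le) (ℕ.<⇒≱ lt)
... | no _  | no _   | yes lt = contradiction le (ℕ.<⇒≱ lt)
... | no _  | no _   | no _   = refl

-- The blocks have length h, the path has ℓ + 1 vertices, s + 2 is the length of the longest cycle,
-- and m bounds from below the number of edges that are available at a vertex.
record Sizes (n q d : ℕ) : Set where
  field
    h ℓ s m : ℕ
    h≡      : h ≡ suc ℓ + q
    4h≤n    : h + h + h + h ≤ n
    q+s≤ℓ   : q + s ≤ ℓ
    pools   : m + 4 * d * suc q ≤ suc ℓ
    2q+2≤m  : 2 * suc q ≤ m
    n<6s+6  : n < 6 * suc s
    n≤8m    : n ≤ 8 * m

m<n*[1+m/n] : ∀ m n .{{_ : NonZero n}} → m < n * suc (m ℕ./ n)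
m<n*[1+m/n] m n = begin-strict
  m                          ≡⟨ ℕ.m≡m%n+[m/n]*n m n ⟩
  m ℕ.% n + m ℕ./ n * n      <⟨ ℕ.+-monoˡ-< (m ℕ./ n * n) (ℕ.m%n<n m n) ⟩
  suc (m ℕ./ n) * n          ≡⟨ ℕ.*-comm (suc (m ℕ./ n)) n ⟩
  n * suc (m ℕ./ n)          ∎
  where open ℕ.≤-Reasoning

-- The block size n/5 leaves a gap of n/30 to the cycle length n/6 and of 3n/40 to the pool size
-- n/8. The corrections involve only q, d, q d and constants, all bounded by multiples of D = q d,
-- while 1000 D ≤ n.
sizes : ∀ n q d → 1 ≤ d → 1 ≤ q → q * (1000 * d) ≤ n → Sizes n q d
sizes n q d 1≤d 1≤q large = record
  { h = h ; ℓ = ℓ ; s = s ; m = m ; h≡ = h≡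
  ; 4h≤n = begin
      h + h + h + h       ≤⟨ ℕ.m≤m+n _ h ⟩
      h + h + h + h + h   ≡⟨ five h ⟩
      h * 5               ≤⟨ ℕ.m/n*n≤m n 5 ⟩
      n                   ∎
  ; q+s≤ℓ = ℕ.+-cancelʳ-≤ (suc q) _ _ (ℕ.≤-trans path-long (ℕ.≤-reflexive (trans h≡ (sym (ℕ.+-suc ℓ q)))))
  ; pools = ℕ.+-cancelʳ-≤ q _ _ (ℕ.≤-trans pools-large (ℕ.≤-reflexive h≡))
  ; 2q+2≤m = ℕ.<⇒≤ (ℕ.*-cancelˡ-< 8 _ _ (begin-strict
      8 * (2 * suc q)           ≡⟨ sixteen q ⟩
      16 * 1 + 16 * q           ≤⟨ ℕ.+-mono-≤ (ℕ.*-monoʳ-≤ 16 1≤D) (ℕ.*-monoʳ-≤ 16 q≤D) ⟩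
      16 * D + 16 * D           ≤⟨ ℕ.m≤m+n _ (968 * D) ⟩
      16 * D + 16 * D + 968 * D ≡⟨ thousand D ⟩
      1000 * D                  ≤⟨ 1000D≤n ⟩
      n                         <⟨ m<n*[1+m/n] n 8 ⟩
      8 * m                     ∎))
  ; n<6s+6 = m<n*[1+m/n] n 6
  ; n≤8m = ℕ.<⇒≤ (m<n*[1+m/n] n 8)
  }
  where
  open ℕ.≤-Reasoning
  h = n ℕ./ 5
  s = n ℕ./ 6
  e = n ℕ./ 8
  m = suc e
  D = q * d
  q≤D : q ≤ D
  q≤D = ℕ.m≤m*n q d {{>-nonZero 1≤d}}
  d≤D : d ≤ D
  d≤D = ℕ.m≤n*m d q {{>-nonZero 1≤q}}
  1≤D : 1 ≤ D
  1≤D = ℕ.≤-trans 1≤q q≤D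
  1000D≤n : 1000 * D ≤ n
  1000D≤n = ℕ.≤-trans (ℕ.≤-reflexive (rotate q d)) large
    where
    rotate : ∀ q d → 1000 * (q * d) ≡ q * (1000 * d)
    rotate = solve-∀
  n≤4+5h : n ≤ 4 + 5 * h
  n≤4+5h = s≤s⁻¹ (ℕ.≤-trans (m<n*[1+m/n] n 5) (ℕ.≤-reflexive (ℕ.*-suc 5 h)))
  five : ∀ h → h + h + h + h + h ≡ h * 5
  five = solve-∀
  sixteen : ∀ q → 8 * (2 * suc q) ≡ 16 * 1 + 16 * q
  sixteen = solve-∀
  thousand : ∀ D → 16 * D + 16 * D + 968 * D ≡ 1000 * D
  thousand = solve-∀
  path-long : q + s + suc q ≤ h
  path-long = ℕ.*-cancelˡ-≤ 30 (ℕ.+-cancelʳ-≤ 24 _ _ (begin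
    30 * (q + s + suc q) + 24        ≡⟨ lhs q s ⟩
    60 * q + 54 * 1 + 5 * (s * 6)    ≤⟨ ℕ.+-mono-≤ (ℕ.+-mono-≤ (ℕ.*-monoʳ-≤ 60 q≤D) (ℕ.*-monoʳ-≤ 54 1≤D)) (ℕ.*-monoʳ-≤ 5 (ℕ.m/n*n≤m n 6)) ⟩
    60 * D + 54 * D + 5 * n          ≤⟨ ℕ.m≤m+n _ (886 * D) ⟩
    60 * D + 54 * D + 5 * n + 886 * D ≡⟨ collect D n ⟩
    1000 * D + 5 * n                 ≤⟨ ℕ.+-monoˡ-≤ (5 * n) 1000D≤n ⟩
    6 * n                            ≤⟨ ℕ.*-monoʳ-≤ 6 n≤4+5h ⟩
    6 * (4 + 5 * h)                  ≡⟨ rhs h ⟩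
    30 * h + 24                      ∎))
    where
    lhs : ∀ q s → 30 * (q + s + suc q) + 24 ≡ 60 * q + 54 * 1 + 5 * (s * 6)
    lhs = solve-∀
    collect : ∀ D n → 60 * D + 54 * D + 5 * n + 886 * D ≡ 1000 * D + 5 * n
    collect = solve-∀
    rhs : ∀ h → 6 * (4 + 5 * h) ≡ 30 * h + 24
    rhs = solve-∀
  pools-large : m + 4 * d * suc q + q ≤ h
  pools-large = ℕ.*-cancelˡ-≤ 40 (ℕ.+-cancelʳ-≤ 32 _ _ (begin
    40 * (suc e + 4 * d * suc q + q) + 32                    ≡⟨ lhs e d q ⟩
    72 * 1 + 160 * d + 160 * D + 40 * q + 5 * (e * 8)        ≤⟨ ℕ.+-mono-≤ (ℕ.+-mono-≤ (ℕ.+-monoˡ-≤ (160 * D) (ℕ.+-mono-≤ (ℕ.*-monoʳ-≤ 72 1≤D) (ℕ.*-monoʳ-≤ 160 d≤D))) (ℕ.*-monoʳ-≤ 40 q≤D)) (ℕ.*-monoʳ-≤ 5 (ℕ.m/n*n≤m n 8)) ⟩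
    72 * D + 160 * D + 160 * D + 40 * D + 5 * n              ≤⟨ ℕ.m≤m+n _ (568 * D) ⟩
    72 * D + 160 * D + 160 * D + 40 * D + 5 * n + 568 * D    ≡⟨ collect D n ⟩
    1000 * D + 5 * n                                         ≤⟨ ℕ.+-monoˡ-≤ (5 * n) 1000D≤n ⟩
    6 * n                                                    ≤⟨ ℕ.*-monoˡ-≤ n (ℕ.m≤m+n 6 2) ⟩
    8 * n                                                    ≤⟨ ℕ.*-monoʳ-≤ 8 n≤4+5h ⟩
    8 * (4 + 5 * h)                                          ≡⟨ rhs h ⟩
    40 * h + 32                                              ∎))
    where
    lhs : ∀ e d q → 40 * (suc e + 4 * d * suc q + q) + 32 ≡ 72 * 1 + 160 * d + 160 * (q * d) + 40 * q + 5 * (e * 8)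
    lhs = solve-∀
    collect : ∀ D n → 72 * D + 160 * D + 160 * D + 40 * D + 5 * n + 568 * D ≡ 1000 * D + 5 * n
    collect = solve-∀
    rhs : ∀ h → 8 * (4 + 5 * h) ≡ 40 * h + 32
    rhs = solve-∀
  ℓ = h ℕ.∸ suc q
  h≡ : h ≡ suc ℓ + q
  h≡ = trans (sym (ℕ.m∸n+n≡m (ℕ.≤-trans (ℕ.m≤n+m (suc q) (q + s)) path-long))) (ℕ.+-suc ℓ q)

-- One of the eight factors 2u/m absorbs the ratio n/u, since n ≤ 8m. Each of the other seven is at
-- most 2/5, and 12 · 8 · 2 · (2/5)^7 < 1.
small-weights : ∀ {n m u} → n ≤ 8 * m → u ≤ n ℕ./ 40 → 2 * u ≤ m × 12 * n * (2 * u) ^ 8 ≤ u * m ^ 8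
small-weights {n} {m} {u} n≤8m u≤ = ℕ.≤-trans (ℕ.*-monoˡ-≤ u (ℕ.m≤m+n 2 3)) 5u≤m , (begin
  12 * n * (2 * u * (2 * u) ^ 7)          ≤⟨ ℕ.*-monoˡ-≤ (2 * u * (2 * u) ^ 7) (ℕ.*-monoʳ-≤ 12 n≤8m) ⟩
  12 * (8 * m) * (2 * u * (2 * u) ^ 7)    ≡⟨ cong (λ x → 12 * (8 * m) * (2 * u * x)) (^-distribʳ-* 7 2 u) ⟩
  12 * (8 * m) * (2 * u * (128 * u ^ 7))  ≡⟨ rearrange m u 128 (u ^ 7) ⟩
  u * m * (192 * 128 * u ^ 7)             ≤⟨ ℕ.*-monoʳ-≤ (u * m) (ℕ.*-monoˡ-≤ (u ^ 7) (ℕ.≤ᵇ⇒≤ (192 * 128) (5 ^ 7) _)) ⟩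
  u * m * (5 ^ 7 * u ^ 7)                 ≡⟨ cong (u * m *_) (^-distribʳ-* 7 5 u) ⟨
  u * m * (5 * u) ^ 7                     ≤⟨ ℕ.*-monoʳ-≤ (u * m) (ℕ.^-monoˡ-≤ 7 5u≤m) ⟩
  u * m * m ^ 7                           ≡⟨ ℕ.*-assoc u m (m ^ 7) ⟩
  u * m ^ 8                               ∎)
  where
  open ℕ.≤-Reasoning
  rearrange : ∀ m u k x → 12 * (8 * m) * (2 * u * (k * x)) ≡ u * m * (192 * k * x)
  rearrange = solve-∀
  5u≤m : 5 * u ≤ m
  5u≤m = ℕ.*-cancelˡ-≤ 8 (begin
    8 * (5 * u)      ≡⟨ ℕ.*-assoc 8 5 u ⟨
    40 * u           ≤⟨ ℕ.*-monoʳ-≤ 40 u≤ ⟩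
    40 * (n ℕ./ 40)  ≡⟨ ℕ.*-comm 40 (n ℕ./ 40) ⟩
    n ℕ./ 40 * 40    ≤⟨ ℕ.m/n*n≤m n 40 ⟩
    n                ≤⟨ n≤8m ⟩
    8 * m            ∎)

cycle-mono : ∀ {n k} {p p′ : Position n} → p ⊑ p′ → Cycle (clientGraph p) k → Cycle (clientGraph p′) k
cycle-mono p⊑p′ C = record
  { 3≤k = 3≤k ; vertex = vertex ; distinct = distinct
  ; adjacent = λ i j i→j → p⊑p′ {vertex i} {vertex j} (adjacent i j i→j) }
  where open Cycle C

module Assembly {n q d : ℕ} (1≤d : 1 ≤ d) (sz : Sizes n q d) where
  open Sizes sz

  cls : Fin n → Class
  cls v = class h (toℕ v)

  I J : Fin n → Set
  I v = toℕ v < h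
  J v = h + h + h ≤ toℕ v

  open Cycles {n} {q} I J (λ {x} Ix Jx → ℕ.<⇒≱ Ix (ℕ.≤-trans (ℕ.m≤n+m h (h + h)) Jx))

  IJ⇒inA : ∀ {v} → I v ⊎ J v → cls v ≡ inA
  IJ⇒inA (inj₁ Iv) = class-first h Iv
  IJ⇒inA (inj₂ Jv) = class-last h Jv

  3h≤n : h + h + h ≤ n
  3h≤n = ℕ.≤-trans (ℕ.m≤m+n _ h) 4h≤n
  2h≤n : h + h ≤ n
  2h≤n = ℕ.≤-trans (ℕ.m≤m+n _ h) 3h≤n

  path-fits : suc ℓ + q ≤ n
  path-fits = subst (_≤ n) h≡ (ℕ.≤-trans (ℕ.m≤m+n h h) 2h≤n)

  pathBlock : Fin (suc ℓ + q) → Fin n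
  pathBlock = block 0 (suc ℓ + q) path-fits

  pathBlock-I : ∀ i → I (pathBlock i)
  pathBlock-I i = subst₂ _<_ (sym (toℕ-block 0 (suc ℓ + q) path-fits i)) (sym h≡) (Fin.toℕ<n i)

  leaves-fit : h + h + h + (suc q + q) ≤ n
  leaves-fit = ℕ.≤-trans (ℕ.+-monoʳ-≤ (h + h + h) (subst (suc q + q ≤_) (sym h≡)
    (ℕ.+-monoˡ-≤ q (s≤s (ℕ.≤-trans (ℕ.m≤m+n q s) q+s≤ℓ))))) 4h≤n

  leafBlock : Fin (suc q + q) → Fin n
  leafBlock = block (h + h + h) (suc q + q) leaves-fit

  leafBlock-J : ∀ i → J (leafBlock i)
  leafBlock-J i = subst (h + h + h ≤_) (sym (toℕ-block (h + h + h) (suc q + q) leaves-fit i)) (ℕ.m≤m+n _ _)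

  k : ℕ
  k = n ℕ./ 40

  module Pools {p : Position n} (C : Chords (suc ℓ) (s + 1) p) where
    open Chords C

    pathVertex : Fin (suc ℓ) → Fin n
    pathVertex = vertex ∘ toℕ

    members : Class → List (Fin n)
    members inA = tabulate pathVertex
    members inB = tabulate (block h h 2h≤n)
    members inC = tabulate (block (h + h) h 3h≤n)

    class-members : ∀ r {x} → x ∈ members r → cls x ≡ r
    class-members inA x∈ with ∈-tabulate⁻ {f = pathVertex} x∈
    ... | i , refl = class-first h (inI (Fin.toℕ<n i))
    class-members inB x∈ with ∈-tabulate⁻ {f = block h h 2h≤n} x∈
    ... | i , refl = trans (cong (class h) (toℕ-block h h 2h≤n i)) (class-second h (toℕ i) (Fin.toℕ<n i))
    class-members inC x∈ with ∈-tabulate⁻ {f = block (h + h) h 3h≤n} x∈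
    ... | i , refl = trans (cong (class h) (toℕ-block (h + h) h 3h≤n i)) (class-third h (toℕ i) (Fin.toℕ<n i))

    members-unique : ∀ r → Unique (members r)
    members-unique inA = Unique.tabulate⁺ λ {i} {j} eq → Fin.toℕ-injective (inj (Fin.toℕ<n i) (Fin.toℕ<n j) eq)
    members-unique inB = Unique.tabulate⁺ (block-injective h h 2h≤n)
    members-unique inC = Unique.tabulate⁺ (block-injective (h + h) h 3h≤n)

    ℓ<h : suc ℓ ≤ h
    ℓ<h = subst (suc ℓ ≤_) (sym h≡) (ℕ.m≤m+n (suc ℓ) q)

    members-size : ∀ r → m + 4 * d * suc q ≤ length (members r)
    members-size inA = subst (m + 4 * d * suc q ≤_) (sym (List.length-tabulate pathVertex)) pools
    members-size inB = subst (m + 4 * d * suc q ≤_) (sym (List.length-tabulate (block h h 2h≤n))) (ℕ.≤-trans pools ℓ<h)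
    members-size inC = subst (m + 4 * d * suc q ≤_) (sym (List.length-tabulate (block (h + h) h 3h≤n))) (ℕ.≤-trans pools ℓ<h)

    pool : Fin n → List (Fin n)
    pool v = members (next (cls v))

    class-pool : ∀ {v x} → x ∈ pool v → cls x ≡ next (cls v)
    class-pool {v} = class-members (next (cls v))

    one-way : ∀ {u v} → u ∈ pool v → v ∉ pool u
    one-way {u} {v} u∈ v∈ = next²≢id (cls v) (trans (class-pool {u} v∈) (cong next (class-pool {v} u∈)))

    -- Everything offered in the cycle stage lies inside A, whereas an edge into a pool always
    -- changes the class.
    pool-fresh : ∀ {v x} → x ∈ pool v → Fresh p v x
    pool-fresh {v} {x} x∈ = frame λ (IJv , IJx) →
      inB≢inA (trans (sym (cong next (IJ⇒inA {v} IJv))) (trans (sym (class-pool {v} x∈)) (IJ⇒inA {x} IJx)))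
      where
      inB≢inA : inB ≢ inA
      inB≢inA ()

    open Expansion {n} {q} m (4 * d) 2q+2≤m pool (λ v → members-unique (next (cls v)))
      (λ v → members-size (next (cls v))) one-way (events d k) public

    -- Following links round the cycle of classes reaches a vertex of C, whose link ends on the
    -- path, and the path leads to its first vertex.
    connected : ∀ {p′} → p ⊑ p′ → (∀ v → Linked p′ v) → Connected (clientGraph p′)
    connected {p′} p⊑p′ link u v = reach u ◅◅ reverse (λ {x} {y} → symm (clientGraph p′) {x} {y}) (reach v)
      where
      Reach : Fin n → Set
      Reach x = Star (AdjC p′) x (vertex 0)
      along : ∀ i → i < suc ℓ → Reach (vertex i)
      along zero    _  = ε
      along (suc i) i< = symm (clientGraph p′) {vertex i} {vertex (suc i)} (p⊑p′ {vertex i} {vertex (suc i)} (adj i<))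
                       ◅ along i (ℕ.<-trans (ℕ.n<1+n i) i<)
      reach-path : ∀ {x} → x ∈ members inA → Reach x
      reach-path x∈ with ∈-tabulate⁻ {f = pathVertex} x∈
      ... | i , refl = along (toℕ i) (Fin.toℕ<n i)
      via : ∀ r → (∀ {x} → x ∈ members (next r) → Reach x) → ∀ {v} → cls v ≡ r → Reach v
      via r reach-next {v} cls≡ = let x , x∈ , vx = link v in
        vx ◅ reach-next (subst (λ r → x ∈ members (next r)) cls≡ x∈)
      reach-c : ∀ {v} → cls v ≡ inC → Reach v
      reach-c = via inC reach-path
      reach-b : ∀ {v} → cls v ≡ inB → Reach v
      reach-b = via inB (reach-c ∘ class-members inC)
      reach-a : ∀ {v} → cls v ≡ inA → Reach v
      reach-a = via inA (reach-b ∘ class-members inB)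
      reach : ∀ v → Reach v
      reach v with cls v in eq
      ... | inA = reach-a eq
      ... | inB = reach-b eq
      ... | inC = reach-c eq

  Goal : .{{_ : NonZero (20 * d)}} → Graph n → Set
  Goal G = IsExpander ((+ d / 2) ℚ.- 1ℚ) (+ 1 / (20 * d)) G
    × ((k : ℕ) → 3 ≤ k → + k ℤ.≤ ceiling (+ n / 6) → Cycle G k)
    × Connected G

  1≤m : 1 ≤ m
  1≤m = ℕ.≤-trans (s≤s z≤n) 2q+2≤m

  -- The cycle stage takes at most 2n rounds and the expansion stage 4dn, which makes at most 6nd.
  rounds : ℓ + (suc q + s) + length (allFin n) * (4 * d) ≤ 200 * n * d
  rounds = begin
    ℓ + (suc q + s) + length (allFin n) * (4 * d)   ≡⟨ cong (λ l → ℓ + (suc q + s) + l * (4 * d)) (List.length-tabulate {n = n} id) ⟩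
    ℓ + suc (q + s) + n * (4 * d)                   ≤⟨ ℕ.+-monoˡ-≤ (n * (4 * d)) (ℕ.+-mono-≤ ℓ≤n (ℕ.≤-trans (s≤s q+s≤ℓ) 1+ℓ≤n)) ⟩
    n + n + n * (4 * d)                             ≡⟨ cong (λ x → x + x + n * (4 * d)) (ℕ.*-identityʳ n) ⟨
    n * 1 + n * 1 + n * (4 * d)                     ≤⟨ ℕ.+-monoˡ-≤ (n * (4 * d)) (ℕ.+-mono-≤ (ℕ.*-monoʳ-≤ n 1≤d) (ℕ.*-monoʳ-≤ n 1≤d)) ⟩
    n * d + n * d + n * (4 * d)                     ≤⟨ ℕ.m≤m+n _ (194 * (n * d)) ⟩
    n * d + n * d + n * (4 * d) + 194 * (n * d)     ≡⟨ collect n d ⟩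
    200 * n * d                                     ∎
    where
    open ℕ.≤-Reasoning
    1+ℓ≤n : suc ℓ ≤ n
    1+ℓ≤n = ℕ.≤-trans (ℕ.m≤m+n (suc ℓ) q) path-fits
    ℓ≤n : ℓ ≤ n
    ℓ≤n = ℕ.≤-trans (ℕ.n≤1+n ℓ) 1+ℓ≤n
    collect : ∀ n d → n * d + n * d + n * (4 * d) + 194 * (n * d) ≡ 200 * n * d
    collect = solve-∀

  forceGoal : .{{_ : NonZero (20 * d)}} → Forces {q = q} (Goal ∘ clientGraph) (200 * n * d) start
  forceGoal = weaken rounds (forceChords ℓ s pathBlock (block-injective 0 (suc ℓ + q) path-fits) pathBlock-I
      leafBlock (block-injective (h + h + h) (suc q + q) leaves-fit) leafBlock-J
      (s≤s (ℕ.≤-trans (ℕ.m≤m+n q s) q+s≤ℓ))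
      (subst (_≤ suc ℓ) (sym q+[s+1]≡) (s≤s q+s≤ℓ))
    >>= λ {p} C → let open Pools C in
    mapForces (λ {p′} (p⊑p′ , links , witness) →
        expander d k p′ (m<n*[1+m/n] n 40) witness
      , cycles {p} {p′} C (λ {u} {v} → p⊑p′ {u} {v})
      , connected {p′} (λ {u} {v} → p⊑p′ {u} {v}) (λ v → links (∈-allFin v)))
      (serve (ℕ.≤-trans 1≤d (ℕ.m≤n*m d 4)) (Unique.allFin⁺ n) initially (λ {v} _ → pool-fresh {v})))
    where
    q+[s+1]≡ : q + (s + 1) ≡ suc (q + s)
    q+[s+1]≡ = trans (cong (λ x → q + x) (ℕ.+-comm s 1)) (ℕ.+-suc q s)
    initially : Potential.Φ m (Initial.todo {n} m d {{>-nonZero 1≤m}}) (events d k)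
              < m ^ length (Initial.todo {n} m d {{>-nonZero 1≤m}})
    initially = Initial.initial-Φ m d {{>-nonZero 1≤m}} k (λ _ u≤k → small-weights n≤8m u≤k)
    cycles : ∀ {p p′} → Chords (suc ℓ) (s + 1) p → p ⊑ p′ →
      (k : ℕ) → 3 ≤ k → + k ℤ.≤ ceiling (+ n / 6) → Cycle (clientGraph p′) k
    cycles C p⊑p′ (suc (suc zero)) (s≤s (s≤s ())) _
    cycles {p} {p′} C p⊑p′ (suc (suc (suc t))) _ k≤ = cycle-mono {p = p} {p′} p⊑p′
      (chords⇒cycle (subst (_≤ suc ℓ) (sym q+[s+1]≡) (s≤s q+s≤ℓ)) C (s≤s z≤n)
        (subst (suc t <_) (ℕ.+-comm 1 s) (ℕ.*-cancelʳ-< 6 (suc t) (suc s) (begin-strict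
          suc t * 6         ≤⟨ ℕ.*-monoˡ-≤ 6 (ℕ.n≤1+n (suc t)) ⟩
          suc (suc t) * 6   <⟨ ≤ceiling/⇒ n 6 (suc (suc t)) k≤ ⟩
          n                 <⟨ n<6s+6 ⟩
          6 * suc s         ≡⟨ ℕ.*-comm 6 (suc s) ⟩
          suc s * 6         ∎))))
      where open ℕ.≤-Reasoning

lemma4p11 : (d : ℕ) .{{_ : NonZero d}} → 4 ≤ d →
    ∃[ n₀ ] ((n : ℕ) → n₀ ≤ n → (q : ℕ) → 1 ≤ q →
    fromℕ q ℚ.≤ _/_ (+ n) (1000 * d) {{m*n≢0 1000 d}} →
    WaiterCanEnsure n q (200 * n * d) (λ G →
    IsExpander ((+ d / 2) ℚ.- 1ℚ) (_/_ (+ 1) (20 * d) {{m*n≢0 20 d}}) G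
    × ((k : ℕ) → 3 ≤ k → + k ℤ.≤ ceiling (+ n / 6) → Cycle G k)
    × Connected G))
lemma4p11 d 4≤d = 0 , λ n _ q 1≤q q≤n/1000d →
  forces⇒ensures (Assembly.forceGoal 1≤d
    (sizes n q d 1≤d 1≤q (fromℕ≤/⇒ q n (1000 * d) {{m*n≢0 1000 d}} q≤n/1000d)) {{m*n≢0 20 d}})
  where
  1≤d : 1 ≤ d
  1≤d = ℕ.≤-trans (s≤s z≤n) 4≤d
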